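{- $f(m)\leq \frac{(m-1)(m-2\sqrt{m})}{8}$.
   Context: For a graph $G$, $\lambda(G)$ denotes the spectral radius of $G$. $f(m)$ denotes the minimum number of copies of 4-cycles over all labelled graphs $G$ on $m$ edges with $\lambda(G)>\sqrt{m}$.
   Formalization: The bound is stated for m ≥ 4 only: for m ≤ 2 no graph on m edges has λ(G) > √m, so f(m) is undefined, and for m = 3 the triangle gives f(3) = 0 while the claimed bound is negative. -}

module Defs where

open import Data.Bool.Base using (Bool; true; false; T; _∧_; if_then_else_)
open import Data.Fin.Base using (Fin; toℕ)
open import Data.Integer.Base using (+_)
import Data.Integer.Base as ℤ
import Data.Integer.Properties as ℤ
open import Data.Nat.Base as ℕ using (ℕ; zero; suc; _<ᵇ_)
import Data.Nat.Properties as ℕ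
open import Data.Nat.Tactic.RingSolver using (solve-∀)
open import Data.Product.Base using (∃-syntax; _×_; _,_)
open import Data.Rational.Base as ℚ using (ℚ; mkℚ; 0ℚ; 1ℚ; ½; toℚᵘ)
import Data.Rational.Properties as ℚ
open import Data.Rational.Solver using (module +-*-Solver)
import Data.Rational.Unnormalised.Base as ℚᵘ
import Data.Rational.Unnormalised.Properties as ℚᵘ
open import Data.Sum.Base using (_⊎_; inj₁; inj₂)
open import Data.Unit.Base using (tt)
open import Data.Vec.Functional using (Vector; foldr)
open import Relation.Binary.PropositionalEquality
  using (_≡_; refl; sym; trans; cong; cong₂; subst; subst₂)
open import Relation.Nullary using (¬_)

-‿≤ : ∀ p q {r} → p ℚ.≤ r ℚ.+ q → p ℚ.- q ℚ.≤ r
-‿≤ p q {r} p≤r+q = begin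
  p ℚ.- q           ≤⟨ ℚ.+-monoˡ-≤ (ℚ.- q) p≤r+q ⟩
  (r ℚ.+ q) ℚ.- q   ≡⟨ solve 2 (λ r q → (r :+ q) :+ (:- q) := r) refl r q ⟩
  r                 ∎
  where open ℚ.≤-Reasoning
        open +-*-Solver

∣-∣≤ : ∀ p q {r} → p ℚ.≤ r ℚ.+ q → q ℚ.≤ r ℚ.+ p → ℚ.∣ p ℚ.- q ∣ ℚ.≤ r
∣-∣≤ p q {r} p≤ q≤ with ℚ.∣p∣≡p∨∣p∣≡-p (p ℚ.- q)
... | inj₁ eq = subst (ℚ._≤ r) (sym eq) (-‿≤ p q p≤)
... | inj₂ eq = subst (ℚ._≤ r) (sym (trans eq swap)) (-‿≤ q p q≤)
  where open +-*-Solver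
        swap : ℚ.- (p ℚ.- q) ≡ q ℚ.- p
        swap = solve 2 (λ p q → :- (p :+ (:- q)) := q :+ (:- p)) refl p q

∣p∣≤∣p-q∣+∣q∣ : ∀ p q → ℚ.∣ p ∣ ℚ.≤ ℚ.∣ p ℚ.- q ∣ ℚ.+ ℚ.∣ q ∣
∣p∣≤∣p-q∣+∣q∣ p q = subst (λ t → ℚ.∣ t ∣ ℚ.≤ ℚ.∣ p ℚ.- q ∣ ℚ.+ ℚ.∣ q ∣)
  (solve 2 (λ p q → (p :+ (:- q)) :+ q := p) refl p q)
  (ℚ.∣p+q∣≤∣p∣+∣q∣ (p ℚ.- q) q)
  where open +-*-Solver

∣-∣-sym : ∀ p q → ℚ.∣ p ℚ.- q ∣ ≡ ℚ.∣ q ℚ.- p ∣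
∣-∣-sym p q = trans (sym (ℚ.∣-p∣≡∣p∣ (p ℚ.- q)))
  (cong ℚ.∣_∣ (solve 2 (λ p q → :- (p :+ (:- q)) := q :+ (:- p)) refl p q))
  where open +-*-Solver

∣∣-∣∣≤ : ∀ p q → ℚ.∣ ℚ.∣ p ∣ ℚ.- ℚ.∣ q ∣ ∣ ℚ.≤ ℚ.∣ p ℚ.- q ∣
∣∣-∣∣≤ p q = ∣-∣≤ ℚ.∣ p ∣ ℚ.∣ q ∣ (∣p∣≤∣p-q∣+∣q∣ p q)
  (subst (λ t → ℚ.∣ q ∣ ℚ.≤ t ℚ.+ ℚ.∣ p ∣) (∣-∣-sym q p) (∣p∣≤∣p-q∣+∣q∣ q p))

half-pos : ∀ {ε} → 0ℚ ℚ.< ε → 0ℚ ℚ.< ½ ℚ.* ε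
half-pos {ε} 0<ε = subst (ℚ._< ½ ℚ.* ε) (ℚ.*-zeroʳ ½) (ℚ.*-monoʳ-<-pos ½ 0<ε)

half+half : ∀ ε → ½ ℚ.* ε ℚ.+ ½ ℚ.* ε ≡ ε
half+half ε = trans (sym (ℚ.*-distribʳ-+ ε ½ ½)) (ℚ.*-identityˡ ε)

*-‿-* : ∀ a b c d → a ℚ.* b ℚ.- c ℚ.* d ≡ a ℚ.* (b ℚ.- d) ℚ.+ d ℚ.* (a ℚ.- c)
*-‿-* = solve 4 (λ a b c d → a :* b :+ (:- (c :* d)) :=
                   a :* (b :+ (:- d)) :+ d :* (a :+ (:- c))) refl
  where open +-*-Solver

∣*∣≤ : ∀ {C δ} p q → ℚ.∣ p ∣ ℚ.≤ C → 0ℚ ℚ.< C → ℚ.∣ q ∣ ℚ.≤ δ → ℚ.∣ p ℚ.* q ∣ ℚ.≤ C ℚ.* δ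
∣*∣≤ {C} {δ} p q p≤ 0<C q≤ = begin
  ℚ.∣ p ℚ.* q ∣
    ≡⟨ ℚ.∣p*q∣≡∣p∣*∣q∣ p q ⟩
  ℚ.∣ p ∣ ℚ.* ℚ.∣ q ∣
    ≤⟨ ℚ.*-monoʳ-≤-nonNeg ℚ.∣ q ∣ {{ℚ.nonNegative (ℚ.0≤∣p∣ q)}} p≤ ⟩
  C ℚ.* ℚ.∣ q ∣
    ≤⟨ ℚ.*-monoˡ-≤-nonNeg C {{ℚ.nonNegative (ℚ.<⇒≤ 0<C)}} q≤ ⟩
  C ℚ.* δ ∎
  where open ℚ.≤-Reasoning

divide : ∀ {C ε} → 0ℚ ℚ.< C → 0ℚ ℚ.< ε → ∃[ δ ] (0ℚ ℚ.< δ × C ℚ.* δ ≡ ε)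
divide {C} {ε} 0<C 0<ε = C⁻¹ ℚ.* ε , 0<δ , eq
  where
  instance
    nz : ℚ.NonZero C
    nz = ℚ.>-nonZero 0<C
  C⁻¹ : ℚ
  C⁻¹ = ℚ.1/ C
  0<δ : 0ℚ ℚ.< C⁻¹ ℚ.* ε
  0<δ = subst (ℚ._< C⁻¹ ℚ.* ε) (ℚ.*-zeroʳ C⁻¹)
    (ℚ.*-monoʳ-<-pos C⁻¹ {{ℚ.1/pos⇒pos C {{ℚ.positive 0<C}}}} 0<ε)
  eq : C ℚ.* (C⁻¹ ℚ.* ε) ≡ ε
  eq = trans (sym (ℚ.*-assoc C C⁻¹ ε))
    (trans (cong (ℚ._* ε) (ℚ.*-inverseʳ C)) (ℚ.*-identityˡ ε))

IsCauchy : (ℕ → ℚ) → Set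
IsCauchy x = ∀ ε → 0ℚ ℚ.< ε →
  ∃[ N ] (∀ i j → N ℕ.≤ i → N ℕ.≤ j → ℚ.∣ x i ℚ.- x j ∣ ℚ.≤ ε)

record ℝ : Set where
  constructor mkℝ
  field
    seq    : ℕ → ℚ
    cauchy : IsCauchy seq

open ℝ public

infix 4 _≈_ _<_ _≤_ _#_

record _≈_ (x y : ℝ) : Set where
  constructor mk≈
  field
    close : ∀ ε → 0ℚ ℚ.< ε →
      ∃[ N ] (∀ i → N ℕ.≤ i → ℚ.∣ seq x i ℚ.- seq y i ∣ ℚ.≤ ε)

record _<_ (x y : ℝ) : Set where
  constructor mk<
  field
    gap   : ℚ
    0<gap : 0ℚ ℚ.< gap
    apart : ∃[ N ] (∀ i → N ℕ.≤ i → seq x i ℚ.+ gap ℚ.≤ seq y i)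

_≤_ : ℝ → ℝ → Set
x ≤ y = ¬ (y < x)

_#_ : ℝ → ℝ → Set
x # y = x < y ⊎ y < x

abstract

  const-cauchy : ∀ q → IsCauchy (λ _ → q)
  const-cauchy q ε 0<ε = 0 , λ _ _ _ _ →
    subst (λ t → ℚ.∣ t ∣ ℚ.≤ ε) (sym (ℚ.+-inverseʳ q)) (ℚ.<⇒≤ 0<ε)

  +-cauchy : ∀ x y → IsCauchy x → IsCauchy y → IsCauchy (λ i → x i ℚ.+ y i)
  +-cauchy x y cx cy ε 0<ε
    with M , p ← cx _ (half-pos 0<ε)
       | N , q ← cy _ (half-pos 0<ε) = M ℕ.⊔ N , λ i j i≥ j≥ → begin
    ℚ.∣ (x i ℚ.+ y i) ℚ.- (x j ℚ.+ y j) ∣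
      ≡⟨ cong ℚ.∣_∣ (solve 4 (λ a b c d → (a :+ b) :+ (:- (c :+ d)) :=
           (a :+ (:- c)) :+ (b :+ (:- d))) refl (x i) (y i) (x j) (y j)) ⟩
    ℚ.∣ (x i ℚ.- x j) ℚ.+ (y i ℚ.- y j) ∣
      ≤⟨ ℚ.∣p+q∣≤∣p∣+∣q∣ (x i ℚ.- x j) (y i ℚ.- y j) ⟩
    ℚ.∣ x i ℚ.- x j ∣ ℚ.+ ℚ.∣ y i ℚ.- y j ∣
      ≤⟨ ℚ.+-mono-≤ (p i j (ℕ.m⊔n≤o⇒m≤o M N i≥) (ℕ.m⊔n≤o⇒m≤o M N j≥))
                    (q i j (ℕ.m⊔n≤o⇒n≤o M N i≥) (ℕ.m⊔n≤o⇒n≤o M N j≥)) ⟩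
    ½ ℚ.* ε ℚ.+ ½ ℚ.* ε
      ≡⟨ half+half ε ⟩
    ε ∎
    where open ℚ.≤-Reasoning
          open +-*-Solver

  neg-cauchy : ∀ x → IsCauchy x → IsCauchy (λ i → ℚ.- x i)
  neg-cauchy x cx ε 0<ε with N , p ← cx ε 0<ε = N , λ i j i≥ j≥ →
    subst (ℚ._≤ ε)
      (trans (sym (ℚ.∣-p∣≡∣p∣ (x i ℚ.- x j))) (cong ℚ.∣_∣ (ℚ.neg-distrib-+ (x i) (ℚ.- x j))))
      (p i j i≥ j≥)

  abs-cauchy : ∀ x → IsCauchy x → IsCauchy (λ i → ℚ.∣ x i ∣)
  abs-cauchy x cx ε 0<ε with N , p ← cx ε 0<ε = N , λ i j i≥ j≥ →
    ℚ.≤-trans (∣∣-∣∣≤ (x i) (x j)) (p i j i≥ j≥)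

  cauchy⇒bounded : ∀ x → IsCauchy x →
    ∃[ B ] (0ℚ ℚ.< B × ∃[ N ] (∀ i → N ℕ.≤ i → ℚ.∣ x i ∣ ℚ.≤ B))
  cauchy⇒bounded x cx with N , p ← cx 1ℚ (ℚ.positive⁻¹ 1ℚ) =
    1ℚ ℚ.+ ℚ.∣ x N ∣ ,
    ℚ.+-mono-<-≤ (ℚ.positive⁻¹ 1ℚ) (ℚ.0≤∣p∣ (x N)) ,
    N , λ i i≥ → ℚ.≤-trans (∣p∣≤∣p-q∣+∣q∣ (x i) (x N))
                   (ℚ.+-monoˡ-≤ ℚ.∣ x N ∣ (p i N i≥ ℕ.≤-refl))

  *-cauchy : ∀ x y → IsCauchy x → IsCauchy y → IsCauchy (λ i → x i ℚ.* y i)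
  *-cauchy x y cx cy ε 0<ε = combine (cauchy⇒bounded x cx) (cauchy⇒bounded y cy)
    where
    open ℚ.≤-Reasoning
    combine : ∃[ A ] (0ℚ ℚ.< A × ∃[ K ] (∀ i → K ℕ.≤ i → ℚ.∣ x i ∣ ℚ.≤ A)) →
              ∃[ B ] (0ℚ ℚ.< B × ∃[ L ] (∀ i → L ℕ.≤ i → ℚ.∣ y i ∣ ℚ.≤ B)) →
              ∃[ R ] (∀ i j → R ℕ.≤ i → R ℕ.≤ j → ℚ.∣ x i ℚ.* y i ℚ.- x j ℚ.* y j ∣ ℚ.≤ ε)
    combine (A , 0<A , K , a) (B , 0<B , L , b) =
      let δ , 0<δ , [A+B]δ≡ε = divide (ℚ.+-mono-< 0<A 0<B) 0<ε
          M , p = cx δ 0<δ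
          N , q = cy δ 0<δ
      in (K ℕ.⊔ L) ℕ.⊔ (M ℕ.⊔ N) , λ i j i≥ j≥ →
      let KL≤i = ℕ.m⊔n≤o⇒m≤o (K ℕ.⊔ L) (M ℕ.⊔ N) i≥
          MN≤i = ℕ.m⊔n≤o⇒n≤o (K ℕ.⊔ L) (M ℕ.⊔ N) i≥
          KL≤j = ℕ.m⊔n≤o⇒m≤o (K ℕ.⊔ L) (M ℕ.⊔ N) j≥
          MN≤j = ℕ.m⊔n≤o⇒n≤o (K ℕ.⊔ L) (M ℕ.⊔ N) j≥
      in begin
      ℚ.∣ x i ℚ.* y i ℚ.- x j ℚ.* y j ∣
        ≡⟨ cong ℚ.∣_∣ (*-‿-* (x i) (y i) (x j) (y j)) ⟩
      ℚ.∣ x i ℚ.* (y i ℚ.- y j) ℚ.+ y j ℚ.* (x i ℚ.- x j) ∣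
        ≤⟨ ℚ.∣p+q∣≤∣p∣+∣q∣ (x i ℚ.* (y i ℚ.- y j)) (y j ℚ.* (x i ℚ.- x j)) ⟩
      ℚ.∣ x i ℚ.* (y i ℚ.- y j) ∣ ℚ.+ ℚ.∣ y j ℚ.* (x i ℚ.- x j) ∣
        ≤⟨ ℚ.+-mono-≤
             (∣*∣≤ (x i) (y i ℚ.- y j) (a i (ℕ.m⊔n≤o⇒m≤o K L KL≤i)) 0<A
               (q i j (ℕ.m⊔n≤o⇒n≤o M N MN≤i) (ℕ.m⊔n≤o⇒n≤o M N MN≤j)))
             (∣*∣≤ (y j) (x i ℚ.- x j) (b j (ℕ.m⊔n≤o⇒n≤o K L KL≤j)) 0<B
               (p i j (ℕ.m⊔n≤o⇒m≤o M N MN≤i) (ℕ.m⊔n≤o⇒m≤o M N MN≤j))) ⟩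
      A ℚ.* δ ℚ.+ B ℚ.* δ
        ≡⟨ ℚ.*-distribʳ-+ δ A B ⟨
      (A ℚ.+ B) ℚ.* δ
        ≡⟨ [A+B]δ≡ε ⟩
      ε ∎

fromℚ : ℚ → ℝ
fromℚ q = mkℝ (λ _ → q) (const-cauchy q)

fromℕ : ℕ → ℝ
fromℕ n = fromℚ (+ n ℚ./ 1)

0ℝ 1ℝ : ℝ
0ℝ = fromℕ 0
1ℝ = fromℕ 1

infixl 6 _+_ _-_
infixl 7 _*_
infix  8 -_

_+_ : ℝ → ℝ → ℝ
x + y = mkℝ (λ i → seq x i ℚ.+ seq y i) (+-cauchy (seq x) (seq y) (cauchy x) (cauchy y))

_*_ : ℝ → ℝ → ℝ
x * y = mkℝ (λ i → seq x i ℚ.* seq y i) (*-cauchy (seq x) (seq y) (cauchy x) (cauchy y))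

-_ : ℝ → ℝ
- x = mkℝ (λ i → ℚ.- seq x i) (neg-cauchy (seq x) (cauchy x))

_-_ : ℝ → ℝ → ℝ
x - y = x + - y

∣_∣ : ℝ → ℝ
∣ x ∣ = mkℝ (λ i → ℚ.∣ seq x i ∣) (abs-cauchy (seq x) (cauchy x))

-- ⌊√n⌋
isqrt : ℕ → ℕ
isqrt zero    = 0
isqrt (suc n) = step (isqrt n)
  module Isqrt where
  step : ℕ → ℕ
  step s = if suc s ℕ.* suc s ℕ.≤ᵇ suc n then suc s else s

isqrt-lower : ∀ n → isqrt n ℕ.* isqrt n ℕ.≤ n
isqrt-lower zero    = ℕ.z≤n
isqrt-lower (suc n) = go (isqrt n) (isqrt-lower n)
  where
  go : ∀ s → s ℕ.* s ℕ.≤ n → Isqrt.step n s ℕ.* Isqrt.step n s ℕ.≤ suc n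
  go s s²≤n with suc s ℕ.* suc s ℕ.≤ᵇ suc n in eq
  ... | true  = ℕ.≤ᵇ⇒≤ (suc s ℕ.* suc s) (suc n) (subst T (sym eq) tt)
  ... | false = ℕ.m≤n⇒m≤1+n s²≤n

isqrt-upper : ∀ n → n ℕ.< suc (isqrt n) ℕ.* suc (isqrt n)
isqrt-upper zero    = ℕ.s≤s ℕ.z≤n
isqrt-upper (suc n) = go (isqrt n) (isqrt-upper n)
  where
  go : ∀ s → n ℕ.< suc s ℕ.* suc s →
       suc n ℕ.< suc (Isqrt.step n s) ℕ.* suc (Isqrt.step n s)
  go s n< with suc s ℕ.* suc s ℕ.≤ᵇ suc n in eq
  ... | true  = ℕ.<-≤-trans (ℕ.s≤s n<)
                  (ℕ.*-mono-< (ℕ.n<1+n (suc s)) (ℕ.n<1+n (suc s)))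
  ... | false = ℕ.≰⇒> λ le → subst T eq (ℕ.≤⇒≤ᵇ le)

-- ⌊√(m(i+1)²)⌋ / (i+1), which lies within 1/(i+1) below √m
√-seq : ℕ → ℕ → ℚ
√-seq m i = + isqrt (m ℕ.* (suc i ℕ.* suc i)) ℚ./ suc i

/-mono : ∀ a b c d → a ℕ.* suc d ℕ.≤ c ℕ.* suc b → + a ℚ./ suc b ℚ.≤ + c ℚ./ suc d
/-mono a b c d le = ℚ.toℚᵘ-cancel-≤ (begin
  toℚᵘ (+ a ℚ./ suc b)  ≃⟨ ℚ.toℚᵘ-fromℚᵘ (ℚᵘ.mkℚᵘ (+ a) b) ⟩
  ℚᵘ.mkℚᵘ (+ a) b       ≤⟨ ℚᵘ.*≤* (subst₂ ℤ._≤_ (ℤ.pos-* a (suc d)) (ℤ.pos-* c (suc b))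
                             (ℤ.+≤+ le)) ⟩
  ℚᵘ.mkℚᵘ (+ c) d       ≃⟨ ℚ.toℚᵘ-fromℚᵘ (ℚᵘ.mkℚᵘ (+ c) d) ⟨
  toℚᵘ (+ c ℚ./ suc d)  ∎)
  where open ℚᵘ.≤-Reasoning

1/+/ : ∀ c d → + suc c ℚ./ suc d ≡ + 1 ℚ./ suc d ℚ.+ + c ℚ./ suc d
1/+/ c d = ℚ.toℚᵘ-injective (begin
  toℚᵘ (+ suc c ℚ./ suc d)
    ≈⟨ ℚ.toℚᵘ-fromℚᵘ (ℚᵘ.mkℚᵘ (+ suc c) d) ⟩
  ℚᵘ.mkℚᵘ (+ suc c) d
    ≈⟨ ℚᵘ.*≡* (trans (sym (ℤ.pos-* (suc c) (suc d ℕ.* suc d)))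
         (trans (cong +_ (arith c d)) (trans (ℤ.pos-* (1 ℕ.* suc d ℕ.+ c ℕ.* suc d) (suc d))
           (cong (ℤ._* + suc d) (trans (ℤ.pos-+ (1 ℕ.* suc d) (c ℕ.* suc d))
             (cong₂ ℤ._+_ (ℤ.pos-* 1 (suc d)) (ℤ.pos-* c (suc d)))))))) ⟩
  ℚᵘ.mkℚᵘ (+ 1) d ℚᵘ.+ ℚᵘ.mkℚᵘ (+ c) d
    ≈⟨ ℚᵘ.+-cong (ℚ.toℚᵘ-fromℚᵘ (ℚᵘ.mkℚᵘ (+ 1) d)) (ℚ.toℚᵘ-fromℚᵘ (ℚᵘ.mkℚᵘ (+ c) d)) ⟨
  toℚᵘ (+ 1 ℚ./ suc d) ℚᵘ.+ toℚᵘ (+ c ℚ./ suc d)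
    ≈⟨ ℚ.toℚᵘ-homo-+ (+ 1 ℚ./ suc d) (+ c ℚ./ suc d) ⟨
  toℚᵘ (+ 1 ℚ./ suc d ℚ.+ + c ℚ./ suc d) ∎)
  where
  open import Relation.Binary.Reasoning.Setoid ℚᵘ.≃-setoid
  arith : ∀ c d → suc c ℕ.* (suc d ℕ.* suc d) ≡ (1 ℕ.* suc d ℕ.+ c ℕ.* suc d) ℕ.* suc d
  arith = solve-∀

√-seq-close : ∀ m i j → √-seq m i ℚ.≤ + 1 ℚ./ suc j ℚ.+ √-seq m j
√-seq-close m i j = subst (√-seq m i ℚ.≤_) (1/+/ (s j) j)
  (/-mono (s i) i (suc (s j)) j (ℕ.≮⇒≥ λ gt → ℕ.<-irrefl refl (begin-strict
    m ℕ.* (I ℕ.* I) ℕ.* (J ℕ.* J)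
      ≡⟨ swap m I J ⟩
    m ℕ.* (J ℕ.* J) ℕ.* (I ℕ.* I)
      <⟨ ℕ.*-monoˡ-< (I ℕ.* I) (isqrt-upper (m ℕ.* (J ℕ.* J))) ⟩
    suc (s j) ℕ.* suc (s j) ℕ.* (I ℕ.* I)
      ≡⟨ interchange (suc (s j)) I ⟩
    (suc (s j) ℕ.* I) ℕ.* (suc (s j) ℕ.* I)
      ≤⟨ ℕ.*-mono-≤ (ℕ.<⇒≤ gt) (ℕ.<⇒≤ gt) ⟩
    (s i ℕ.* J) ℕ.* (s i ℕ.* J)
      ≡⟨ interchange (s i) J ⟨
    s i ℕ.* s i ℕ.* (J ℕ.* J)
      ≤⟨ ℕ.*-monoˡ-≤ (J ℕ.* J) (isqrt-lower (m ℕ.* (I ℕ.* I))) ⟩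
    m ℕ.* (I ℕ.* I) ℕ.* (J ℕ.* J) ∎)))
  where
  open ℕ.≤-Reasoning
  s : ℕ → ℕ
  s k = isqrt (m ℕ.* (suc k ℕ.* suc k))
  I J : ℕ
  I = suc i
  J = suc j
  swap : ∀ a b c → a ℕ.* (b ℕ.* b) ℕ.* (c ℕ.* c) ≡ a ℕ.* (c ℕ.* c) ℕ.* (b ℕ.* b)
  swap = solve-∀
  interchange : ∀ a b → a ℕ.* a ℕ.* (b ℕ.* b) ≡ (a ℕ.* b) ℕ.* (a ℕ.* b)
  interchange = solve-∀

archimedean : ∀ ε → 0ℚ ℚ.< ε → ∃[ N ] (∀ i → N ℕ.≤ i → + 1 ℚ./ suc i ℚ.≤ ε)
archimedean ε@(mkℚ (+ zero) d _) 0<ε with () ← ℚ.positive 0<ε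
archimedean ε@(mkℚ ℤ.-[1+ _ ] d _) 0<ε with () ← ℚ.positive 0<ε
archimedean ε@(mkℚ (+ suc n) d _) 0<ε = d , λ i d≤i →
  subst (+ 1 ℚ./ suc i ℚ.≤_) (ℚ.fromℚᵘ-toℚᵘ ε)
    (/-mono 1 i (suc n) d (ℕ.*-mono-≤ (ℕ.s≤s (ℕ.z≤n {n})) (ℕ.s≤s d≤i)))

abstract

  √-cauchy : ∀ m → IsCauchy (√-seq m)
  √-cauchy m ε 0<ε with N , p ← archimedean ε 0<ε = N , λ i j i≥ j≥ →
    ∣-∣≤ (√-seq m i) (√-seq m j)
      (ℚ.≤-trans (√-seq-close m i j) (ℚ.+-monoˡ-≤ (√-seq m j) (p j j≥)))
      (ℚ.≤-trans (√-seq-close m j i) (ℚ.+-monoˡ-≤ (√-seq m i) (p i i≥)))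

√ : ℕ → ℝ
√ m = mkℝ (√-seq m) (√-cauchy m)

record Graph (n : ℕ) : Set where
  field
    adj    : Fin n → Fin n → Bool
    symm   : ∀ i j → adj i j ≡ adj j i
    irrefl : ∀ i → adj i i ≡ false

open Graph public

∑ℕ : ∀ {n} → Vector ℕ n → ℕ
∑ℕ = foldr ℕ._+_ 0

_<ᶠ_ : ∀ {n} → Fin n → Fin n → Bool
i <ᶠ j = toℕ i <ᵇ toℕ j

[_] : Bool → ℕ
[ b ] = if b then 1 else 0

#edges : ∀ {n} → Graph n → ℕ
#edges G = ∑ℕ λ i → ∑ℕ λ j → [ i <ᶠ j ∧ adj G i j ]

-- A copy of C₄ is a subgraph isomorphic to the 4-cycle.  Each such subgraph
-- is a – b – c – d – a for exactly one (a , b , c , d) in which a is its least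
-- vertex and b < d.  Since a < b and a < c are imposed, b < d implies a < d;
-- b ≠ c and c ≠ d follow from irreflexivity.
#C₄ : ∀ {n} → Graph n → ℕ
#C₄ G = ∑ℕ λ a → ∑ℕ λ b → ∑ℕ λ c → ∑ℕ λ d →
  [ a <ᶠ b ∧ a <ᶠ c ∧ b <ᶠ d ∧ adj G a b ∧ adj G b c ∧ adj G c d ∧ adj G d a ]

∑ℝ : ∀ {n} → Vector ℝ n → ℝ
∑ℝ = foldr _+_ 0ℝ

Matrix : ℕ → Set
Matrix n = Fin n → Fin n → ℝ

adjacencyMatrix : ∀ {n} → Graph n → Matrix n
adjacencyMatrix G i j = if adj G i j then 1ℝ else 0ℝ

_*ᵥ_ : ∀ {n} → Matrix n → Vector ℝ n → Vector ℝ n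
(A *ᵥ x) i = ∑ℝ λ j → A i j * x j

IsEigenvalue : ∀ {n} → Matrix n → ℝ → Set
IsEigenvalue {n} A μ =
  ∃[ x ] ((∃[ i ] x i # 0ℝ) × (∀ (i : Fin n) → (A *ᵥ x) i ≈ μ * x i))

-- The largest modulus of an eigenvalue.  The adjacency matrix is real and
-- symmetric, so its eigenvalues are all real.
IsSpectralRadius : ∀ {n} → Graph n → ℝ → Set
IsSpectralRadius G r =
  (∃[ μ ] (IsEigenvalue (adjacencyMatrix G) μ × ∣ μ ∣ ≈ r)) ×
  (∀ μ → IsEigenvalue (adjacencyMatrix G) μ → ∣ μ ∣ ≤ r)

IsMinimum : (ℕ → Set) → ℕ → Set
IsMinimum P v = P v × (∀ w → P w → v ℕ.≤ w)

record Admissible (m : ℕ) {n : ℕ} (G : Graph n) : Set where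
  field
    size        : #edges G ≡ m
    radius      : ℝ
    isRadius    : IsSpectralRadius G radius
    √m<radius   : √ m < radius

-- f⟨ m ⟩≡ v says f(m) = v.  Without excluded middle a nonempty set of naturals
-- is only ¬¬-known to have a minimum, so f is a relation.  For m ≤ 2 no graph
-- has λ > √m and f(m) is undefined; f(3) = 0, attained by the
-- triangle, exceeds (m-1)(m-2√m)/8 < 0.
f⟨_⟩≡_ : ℕ → ℕ → Set
f⟨ m ⟩≡ v = IsMinimum (λ w → ∃[ n ] ∃[ G ] (Admissible m {n} G × #C₄ G ≡ w)) v

module Submission where

-- Put s = ⌊√m⌋ ≥ 2.  The graph used is the pineapple graph: a clique on s + 1
-- vertices, with the remaining q = m - s (s + 1) / 2 edges pendant at one clique
-- vertex, the hub.
--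
-- Its 4-cycles all lie in the clique, so there are 3 (s+1 choose 4) of them, that is
-- (s² - 1)(s² - 2s) / 8 (#C₄-pineapple, which proves the upper bound, and
-- 24*[n+3]C4).  Since s ≤ √m and (x - 1)(x - 2√x)
-- is increasing, this is at most (m - 1)(m - 2√m) / 8 (bound-mono).  The minimum f(m) is
-- no larger than this count.
--
-- For the spectral radius, put σ = s - 1 and N = s + 1.  A vector with entries x (x - σ)
-- at the hub, x on the rest of the clique and x - σ on the leaves is an eigenvector for
-- the eigenvalue x exactly when the hub equation holds, which reads p(x) = 0 for the cubic
--   p(x) = x² (x - σ) - (1 + σ) x - q (x - σ)
--        = (x - σ)(x² - m) - ½ s (s - 1) (N - x).
-- The second form shows p(√m) < 0 because √m < N, while p(N) = 2 (N² - m) > 0, so p has a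
-- zero strictly between √m and N.  To have rational data, √m is replaced by the point
-- a = N - t with t = (N² - m) / 2N, for which a² = m + t² > m and still p(a) ≤ 0
-- (HubPolynomial).  Bisection on [a , N] gives a Cauchy sequence of lower end points,
-- whose limit λ ≥ a > √m is an eigenvalue (root-isEigenvalue).
--
-- No eigenvalue has larger modulus: at an upper end point Λ of the bisection p(Λ) ≥ 0, so
-- the vector above for x = Λ, call it w, is positive with A w ≤ Λ w, and pairing w with
-- the moduli of an eigenvector bounds every eigenvalue by Λ (∣eigenvalue∣≤).  The upper end
-- points converge to λ as well.

open import Defs
open import Algebra.Bundles using (CommutativeRing)
import Algebra.Properties.Semiring.Sum as Sum
open import Data.Bool.Base using (Bool; true; false; _∧_; not; if_then_else_)
open import Data.Bool.Properties using (∧-identityʳ; ∧-zeroʳ)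
open import Data.Fin.Base using (Fin; zero; suc; toℕ)
open import Data.Integer.Base using (+_)
import Data.Integer.Base as ℤ
import Data.Integer.Properties as ℤ
open import Data.Nat.Base using (ℕ; zero; suc; _<ᵇ_; _≡ᵇ_; z≤n; s≤s)
import Data.Nat.Base as ℕ
open import Data.Nat.Combinatorics using (_C_; nC1≡n; nCk+nC[k+1]≡[n+1]C[k+1])
open import Data.Nat.Induction using (<-rec)
import Data.Nat.Properties as ℕ
import Data.Nat.Solver as ℕ
open import Data.Product.Base using (∃-syntax; _×_; _,_; proj₁; proj₂)
open import Data.Rational.Base using (ℚ; 0ℚ; 1ℚ; ½; toℚᵘ)
import Data.Rational.Base as ℚ
import Data.Rational.Properties as ℚ
open import Data.Rational.Solver using (module +-*-Solver)
import Data.Rational.Unnormalised.Base as ℚᵘ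
import Data.Rational.Unnormalised.Properties as ℚᵘ
open import Data.Sum.Base using (inj₁; inj₂)
open import Data.Vec.Functional using (Vector)
open import Relation.Binary.PropositionalEquality
  using (_≡_; refl; sym; trans; cong; cong₂; subst; subst₂; module ≡-Reasoning)
open import Relation.Nullary using (¬_; yes; no; contradiction)

-- Rational arithmetic

-- The natural number n as a rational; fromℕ n is the constant sequence ι n.
-- It is abstract because the normalisation hidden in _/_ must not be unfolded
-- on open terms.
abstract
  ι : ℕ → ℚ
  ι n = + n ℚ./ 1

  /1≡ι : ∀ n → + n ℚ./ 1 ≡ ι n
  /1≡ι n = refl

  ι-0 : ι 0 ≡ 0ℚ
  ι-0 = refl

  ι-1 : ι 1 ≡ 1ℚ
  ι-1 = refl

abstract
  /-*-cancel : ∀ a b → (+ a ℚ./ suc b) ℚ.* ι (suc b) ≡ ι a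
  /-*-cancel a b = ℚ.toℚᵘ-injective (begin
    toℚᵘ ((+ a ℚ./ suc b) ℚ.* ι (suc b))
      ≈⟨ ℚ.toℚᵘ-homo-* (+ a ℚ./ suc b) (ι (suc b)) ⟩
    toℚᵘ (+ a ℚ./ suc b) ℚᵘ.* toℚᵘ (ι (suc b))
      ≈⟨ ℚᵘ.*-cong (ℚ.toℚᵘ-fromℚᵘ (ℚᵘ.mkℚᵘ (+ a) b)) (ℚ.toℚᵘ-fromℚᵘ (ℚᵘ.mkℚᵘ (+ suc b) 0)) ⟩
    ℚᵘ.mkℚᵘ (+ a) b ℚᵘ.* ℚᵘ.mkℚᵘ (+ suc b) 0
      ≈⟨ ℚᵘ.*≡* (trans (ℤ.*-identityʳ _) (cong (λ k → + a ℤ.* + k) (sym (ℕ.*-identityʳ (suc b))))) ⟩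
    ℚᵘ.mkℚᵘ (+ a) 0
      ≈⟨ ℚ.toℚᵘ-fromℚᵘ (ℚᵘ.mkℚᵘ (+ a) 0) ⟨
    toℚᵘ (ι a) ∎)
    where open import Relation.Binary.Reasoning.Setoid ℚᵘ.≃-setoid

  ι-+ : ∀ a b → ι (a ℕ.+ b) ≡ ι a ℚ.+ ι b
  ι-+ zero    b = sym (ℚ.+-identityˡ (ι b))
  ι-+ (suc a) b = begin
    ι (suc (a ℕ.+ b))        ≡⟨ 1/+/ (a ℕ.+ b) 0 ⟩
    1ℚ ℚ.+ ι (a ℕ.+ b)       ≡⟨ cong (1ℚ ℚ.+_) (ι-+ a b) ⟩
    1ℚ ℚ.+ (ι a ℚ.+ ι b)     ≡⟨ ℚ.+-assoc 1ℚ (ι a) (ι b) ⟨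
    (1ℚ ℚ.+ ι a) ℚ.+ ι b     ≡⟨ cong (ℚ._+ ι b) (1/+/ a 0) ⟨
    ι (suc a) ℚ.+ ι b        ∎
    where open ≡-Reasoning

  ι-suc : ∀ a → ι (suc a) ≡ 1ℚ ℚ.+ ι a
  ι-suc a = 1/+/ a 0

  ι-* : ∀ a b → ι (a ℕ.* b) ≡ ι a ℚ.* ι b
  ι-* zero    b = sym (ℚ.*-zeroˡ (ι b))
  ι-* (suc a) b = begin
    ι (b ℕ.+ a ℕ.* b)          ≡⟨ ι-+ b (a ℕ.* b) ⟩
    ι b ℚ.+ ι (a ℕ.* b)        ≡⟨ cong (ι b ℚ.+_) (ι-* a b) ⟩
    ι b ℚ.+ ι a ℚ.* ι b        ≡⟨ solve 2 (λ a b → b :+ a :* b := (con 1ℚ :+ a) :* b) refl (ι a) (ι b) ⟩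
    (1ℚ ℚ.+ ι a) ℚ.* ι b       ≡⟨ cong (ℚ._* ι b) (ι-suc a) ⟨
    ι (suc a) ℚ.* ι b          ∎
    where open ≡-Reasoning
          open +-*-Solver

  ι-mono-≤ : ∀ {a b} → a ℕ.≤ b → ι a ℚ.≤ ι b
  ι-mono-≤ {a} {b} a≤b = /-mono a 0 b 0 (ℕ.*-monoˡ-≤ 1 a≤b)

0≤ι : ∀ n → 0ℚ ℚ.≤ ι n
0≤ι n = subst (ℚ._≤ ι n) ι-0 (ι-mono-≤ {0} {n} ℕ.z≤n)

0<1+ : ∀ {p} → 0ℚ ℚ.≤ p → 0ℚ ℚ.< 1ℚ ℚ.+ p
0<1+ = ℚ.+-mono-<-≤ (ℚ.positive⁻¹ 1ℚ)

0<ι-suc : ∀ n → 0ℚ ℚ.< ι (suc n)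
0<ι-suc n = subst (0ℚ ℚ.<_) (sym (ι-suc n)) (0<1+ (0≤ι n))

0≤1 : 0ℚ ℚ.≤ 1ℚ
0≤1 = ℚ.<⇒≤ (ℚ.positive⁻¹ 1ℚ)

0≤½ : 0ℚ ℚ.≤ ½
0≤½ = ℚ.<⇒≤ (ℚ.positive⁻¹ ½)

0≤+ : ∀ {p q} → 0ℚ ℚ.≤ p → 0ℚ ℚ.≤ q → 0ℚ ℚ.≤ p ℚ.+ q
0≤+ = ℚ.+-mono-≤

0≤* : ∀ {p q} → 0ℚ ℚ.≤ p → 0ℚ ℚ.≤ q → 0ℚ ℚ.≤ p ℚ.* q
0≤* {p} {q} 0≤p 0≤q = ℚ.nonNegative⁻¹ (p ℚ.* q)
  {{ℚ.nonNeg*nonNeg⇒nonNeg p {{ℚ.nonNegative 0≤p}} q {{ℚ.nonNegative 0≤q}}}}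

0<* : ∀ {p q} → 0ℚ ℚ.< p → 0ℚ ℚ.< q → 0ℚ ℚ.< p ℚ.* q
0<* {p} {q} 0<p 0<q = subst (ℚ._< p ℚ.* q) (ℚ.*-zeroʳ p)
  (ℚ.*-monoʳ-<-pos p {{ℚ.positive 0<p}} 0<q)

*-monoˡ-0≤ : ∀ {p q} r → 0ℚ ℚ.≤ r → p ℚ.≤ q → r ℚ.* p ℚ.≤ r ℚ.* q
*-monoˡ-0≤ r 0≤r = ℚ.*-monoˡ-≤-nonNeg r {{ℚ.nonNegative 0≤r}}

*-cancelˡ-0< : ∀ {p q} r → 0ℚ ℚ.< r → r ℚ.* p ℚ.≤ r ℚ.* q → p ℚ.≤ q
*-cancelˡ-0< r 0<r = ℚ.*-cancelˡ-≤-pos r {{ℚ.positive 0<r}}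

-- Inequalities are proved by exhibiting q - p as a visibly nonnegative expression.
≤-by : ∀ {p q} r → 0ℚ ℚ.≤ r → p ℚ.+ r ≡ q → p ℚ.≤ q
≤-by {p} r 0≤r refl = subst (ℚ._≤ p ℚ.+ r) (ℚ.+-identityʳ p) (ℚ.+-monoʳ-≤ p 0≤r)

0≤- : ∀ {p q} → p ℚ.≤ q → 0ℚ ℚ.≤ q ℚ.- p
0≤- {p} {q} p≤q = subst (ℚ._≤ q ℚ.- p) (ℚ.+-inverseʳ p) (ℚ.+-monoˡ-≤ (ℚ.- p) p≤q)

0<- : ∀ {p q} → p ℚ.< q → 0ℚ ℚ.< q ℚ.- p
0<- {p} {q} p<q = subst (ℚ._< q ℚ.- p) (ℚ.+-inverseʳ p) (ℚ.+-monoˡ-< (ℚ.- p) p<q)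

sq-cancel-≤ : ∀ {p q} → 0ℚ ℚ.≤ q → p ℚ.* p ℚ.≤ q ℚ.* q → p ℚ.≤ q
sq-cancel-≤ {p} {q} 0≤q p²≤q² with p ℚ.≤? q
... | yes p≤q = p≤q
... | no  p≰q = contradiction refl (ℚ.<⇒≢ (ℚ.<-≤-trans q²<p² p²≤q²))
  where
  q<p : q ℚ.< p
  q<p = ℚ.≰⇒> p≰q
  q²<p² : q ℚ.* q ℚ.< p ℚ.* p
  q²<p² = ℚ.≤-<-trans (*-monoˡ-0≤ q 0≤q (ℚ.<⇒≤ q<p))
                      (ℚ.*-monoˡ-<-pos p {{ℚ.positive (ℚ.≤-<-trans 0≤q q<p)}} q<p)

-- Roots by bisection

-- If n w ≤ d and 1/n ≤ δ then w ≤ d δ; here r stands for 1/n.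
≤-quotient : ∀ {n r w d δ} → 0ℚ ℚ.< n → r ℚ.* n ≡ 1ℚ → 0ℚ ℚ.≤ d →
             n ℚ.* w ℚ.≤ d → r ℚ.≤ δ → w ℚ.≤ d ℚ.* δ
≤-quotient {n} {r} {w} {d} {δ} 0<n rn≡1 0≤d nw≤d r≤δ = *-cancelˡ-0< n 0<n (begin
  n ℚ.* w              ≤⟨ nw≤d ⟩
  d                    ≡⟨ ℚ.*-identityʳ d ⟨
  d ℚ.* 1ℚ             ≡⟨ cong (d ℚ.*_) rn≡1 ⟨
  d ℚ.* (r ℚ.* n)      ≤⟨ *-monoˡ-0≤ d 0≤d (ℚ.*-monoʳ-≤-nonNeg n
                            {{ℚ.nonNegative (ℚ.<⇒≤ 0<n)}} r≤δ) ⟩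
  d ℚ.* (δ ℚ.* n)      ≡⟨ solve 3 (λ d δ n → d :* (δ :* n) := n :* (d :* δ)) refl d δ n ⟩
  n ℚ.* (d ℚ.* δ)      ∎)
  where open ℚ.≤-Reasoning
        open +-*-Solver

-- Bisection for a function f : ℚ → ℚ with a sign change on [a , a + d].
-- The k-th interval is [lo k , lo k + width k]; no continuity or monotonicity
-- of f is needed for the invariants.
module Bisection
  (f : ℚ → ℚ) (a d : ℚ) (0<d : 0ℚ ℚ.< d)
  (fa≤0 : f a ℚ.≤ 0ℚ) (0≤fb : 0ℚ ℚ.≤ f (a ℚ.+ d))
  where

  width : ℕ → ℚ
  width zero    = d
  width (suc k) = ½ ℚ.* width k

  0<width : ∀ k → 0ℚ ℚ.< width k
  0<width zero    = 0<d
  0<width (suc k) = half-pos (0<width k)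

  lo hi : ℕ → ℚ
  lo zero    = a
  lo (suc k) with f (lo k ℚ.+ width (suc k)) ℚ.≤? 0ℚ
  ... | yes _ = lo k ℚ.+ width (suc k)
  ... | no  _ = lo k
  hi k = lo k ℚ.+ width k

  mid+width : ∀ k → (lo k ℚ.+ width (suc k)) ℚ.+ width (suc k) ≡ hi k
  mid+width k = trans (ℚ.+-assoc (lo k) (width (suc k)) (width (suc k)))
                      (cong (lo k ℚ.+_) (half+half (width k)))

  f-lo : ∀ k → f (lo k) ℚ.≤ 0ℚ
  f-lo zero = fa≤0
  f-lo (suc k) with f (lo k ℚ.+ width (suc k)) ℚ.≤? 0ℚ
  ... | yes fmid≤0 = fmid≤0
  ... | no  _      = f-lo k

  f-hi : ∀ k → 0ℚ ℚ.≤ f (hi k)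
  f-hi zero = 0≤fb
  f-hi (suc k) with f (lo k ℚ.+ width (suc k)) ℚ.≤? 0ℚ
  ... | yes _     = subst (λ x → 0ℚ ℚ.≤ f x) (sym (mid+width k)) (f-hi k)
  ... | no  fmid≰0 = ℚ.<⇒≤ (ℚ.≰⇒> fmid≰0)

  lo≤mid : ∀ k → lo k ℚ.≤ lo k ℚ.+ width (suc k)
  lo≤mid k = ≤-by (width (suc k)) (ℚ.<⇒≤ (0<width (suc k))) refl

  lo-step : ∀ k → lo k ℚ.≤ lo (suc k)
  lo-step k with f (lo k ℚ.+ width (suc k)) ℚ.≤? 0ℚ
  ... | yes _ = lo≤mid k
  ... | no  _ = ℚ.≤-refl

  hi-step : ∀ k → hi (suc k) ℚ.≤ hi k
  hi-step k with f (lo k ℚ.+ width (suc k)) ℚ.≤? 0ℚ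
  ... | yes _ = ℚ.≤-reflexive (mid+width k)
  ... | no  _ = ≤-by (width (suc k)) (ℚ.<⇒≤ (0<width (suc k))) (mid+width k)

  lo≤hi : ∀ k → lo k ℚ.≤ hi k
  lo≤hi k = ≤-by (width k) (ℚ.<⇒≤ (0<width k)) refl

  nested : ∀ {i j} → i ℕ.≤ j → lo i ℚ.≤ lo j × hi j ℚ.≤ hi i
  nested i≤j = go (ℕ.≤⇒≤′ i≤j)
    where
    go : ∀ {i j} → i ℕ.≤′ j → lo i ℚ.≤ lo j × hi j ℚ.≤ hi i
    go ℕ.≤′-refl = ℚ.≤-refl , ℚ.≤-refl
    go (ℕ.≤′-step {j} i≤j) with p , q ← go i≤j =
      ℚ.≤-trans p (lo-step j) , ℚ.≤-trans (hi-step j) q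

  lo-mono : ∀ {i j} → i ℕ.≤ j → lo i ℚ.≤ lo j
  lo-mono i≤j = proj₁ (nested i≤j)

  lo≤hi-earlier : ∀ {i j} → i ℕ.≤ j → lo j ℚ.≤ hi i
  lo≤hi-earlier {j = j} i≤j = ℚ.≤-trans (lo≤hi j) (proj₂ (nested i≤j))

  a≤lo : ∀ k → a ℚ.≤ lo k
  a≤lo k = lo-mono {0} {k} ℕ.z≤n

  hi≤a+d : ∀ k → hi k ℚ.≤ a ℚ.+ d
  hi≤a+d k = proj₂ (nested {0} {k} ℕ.z≤n)

  -- width k = d / 2ᵏ, and 2ᵏ ≥ k + 1.
  width-bound : ∀ k → ι (suc k) ℚ.* width k ℚ.≤ d
  width-bound zero    = ℚ.≤-reflexive (trans (cong (ℚ._* d) ι-1) (ℚ.*-identityˡ d))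
  width-bound (suc k) = subst (λ n → n ℚ.* width (suc k) ℚ.≤ d)
    (sym (trans (ι-suc (suc k)) (cong (1ℚ ℚ.+_) (ι-suc k))))
    (ℚ.≤-trans (halve (ι k) (width k) (0≤ι k) (ℚ.<⇒≤ (0<width k)))
      (subst (λ n → n ℚ.* width k ℚ.≤ d) (ι-suc k) (width-bound k)))
    where
    halve : ∀ n w → 0ℚ ℚ.≤ n → 0ℚ ℚ.≤ w →
            (1ℚ ℚ.+ (1ℚ ℚ.+ n)) ℚ.* (½ ℚ.* w) ℚ.≤ (1ℚ ℚ.+ n) ℚ.* w
    halve n w 0≤n 0≤w = ≤-by (½ ℚ.* (n ℚ.* w))
      (0≤* 0≤½ (0≤* 0≤n 0≤w))
      (solve 2 (λ n w → (con 1ℚ :+ (con 1ℚ :+ n)) :* (con ½ :* w) :+ con ½ :* (n :* w)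
                     := (con 1ℚ :+ n) :* w) refl n w)
      where open +-*-Solver

  abstract
    width→0 : ∀ ε → 0ℚ ℚ.< ε → ∃[ K ] (∀ k → K ℕ.≤ k → width k ℚ.≤ ε)
    width→0 ε 0<ε =
      let δ , 0<δ , dδ≡ε = divide 0<d 0<ε
          K , small      = archimedean δ 0<δ
      in K , λ k K≤k → subst (width k ℚ.≤_) dδ≡ε
           (≤-quotient (0<ι-suc k) (trans (/-*-cancel 1 k) ι-1) (ℚ.<⇒≤ 0<d)
             (width-bound k) (small k K≤k))

  -- Two points of the K-th interval.
  lo≤lo+ : ∀ {ε K i j} → width K ℚ.≤ ε → K ℕ.≤ i → K ℕ.≤ j → lo i ℚ.≤ ε ℚ.+ lo j
  lo≤lo+ {ε} {K} {i} {j} small K≤i K≤j = begin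
    lo i              ≤⟨ lo≤hi-earlier K≤i ⟩
    lo K ℚ.+ width K  ≤⟨ ℚ.+-mono-≤ (lo-mono K≤j) small ⟩
    lo j ℚ.+ ε        ≡⟨ ℚ.+-comm (lo j) ε ⟩
    ε ℚ.+ lo j        ∎
    where open ℚ.≤-Reasoning

  abstract
    lo-cauchy : IsCauchy lo
    lo-cauchy ε 0<ε = from (width→0 ε 0<ε)
      where
      from : ∃[ K ] (∀ k → K ℕ.≤ k → width k ℚ.≤ ε) →
             ∃[ K ] (∀ i j → K ℕ.≤ i → K ℕ.≤ j → ℚ.∣ lo i ℚ.- lo j ∣ ℚ.≤ ε)
      from (K , small) = K , λ i j K≤i K≤j → ∣-∣≤ (lo i) (lo j)
        (lo≤lo+ (small K ℕ.≤-refl) K≤i K≤j) (lo≤lo+ (small K ℕ.≤-refl) K≤j K≤i)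

  -- The limit of the lower end points; it is a zero of f when f is continuous.
  root : ℝ
  root = mkℝ lo lo-cauchy

  -- The upper end points have the same limit.
  ≤root : ∀ y → (∀ k → y ≤ fromℚ (hi k)) → y ≤ root
  ≤root y y≤hi (mk< g 0<g (N , gap)) =
    below (½ ℚ.* g) (half-pos 0<g) (half+half g) (width→0 (½ ℚ.* g) (half-pos 0<g))
    where
    open ℚ.≤-Reasoning
    below : ∀ ε → 0ℚ ℚ.< ε → ε ℚ.+ ε ≡ g →
            ¬ (∃[ K ] (∀ k → K ℕ.≤ k → width k ℚ.≤ ε))
    below ε 0<ε 2ε≡g (K , small) = y≤hi K (mk< ε 0<ε (N ℕ.⊔ K , λ i i≥ → begin
      (lo K ℚ.+ width K) ℚ.+ ε
        ≤⟨ ℚ.+-monoˡ-≤ ε (ℚ.+-mono-≤ (lo-mono (ℕ.m⊔n≤o⇒n≤o N K i≥)) (small K ℕ.≤-refl)) ⟩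
      (lo i ℚ.+ ε) ℚ.+ ε
        ≡⟨ ℚ.+-assoc (lo i) ε ε ⟩
      lo i ℚ.+ (ε ℚ.+ ε)
        ≡⟨ cong (lo i ℚ.+_) 2ε≡g ⟩
      lo i ℚ.+ g
        ≤⟨ gap i (ℕ.m⊔n≤o⇒m≤o N K i≥) ⟩
      seq y i ∎))

-- Finite sums and bounds on eigenvalues

module ∑ℚ = Sum (CommutativeRing.semiring ℚ.+-*-commutativeRing)

-- The sum of a finite family of rationals.
∑ : ∀ {n} → Vector ℚ n → ℚ
∑ = ∑ℚ.sum

∑-mono : ∀ {n} {f g : Vector ℚ n} → (∀ i → f i ℚ.≤ g i) → ∑ f ℚ.≤ ∑ g
∑-mono {zero}  f≤g = ℚ.≤-refl
∑-mono {suc n} f≤g = ℚ.+-mono-≤ (f≤g zero) (∑-mono (λ i → f≤g (suc i)))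

0≤∑ : ∀ {n} {f : Vector ℚ n} → (∀ i → 0ℚ ℚ.≤ f i) → 0ℚ ℚ.≤ ∑ f
0≤∑ {zero}  0≤f = ℚ.≤-refl
0≤∑ {suc n} 0≤f = 0≤+ (0≤f zero) (0≤∑ (λ i → 0≤f (suc i)))

term≤∑ : ∀ {n} {f : Vector ℚ n} → (∀ i → 0ℚ ℚ.≤ f i) → ∀ i → f i ℚ.≤ ∑ f
term≤∑ {suc n} {f} 0≤f zero    = ≤-by (∑ (λ i → f (suc i))) (0≤∑ (λ i → 0≤f (suc i))) refl
term≤∑ {suc n} {f} 0≤f (suc i) = ℚ.≤-trans (term≤∑ (λ i → 0≤f (suc i)) i)
  (≤-by (f zero) (0≤f zero) (ℚ.+-comm _ (f zero)))

∣∑∣≤∑∣∣ : ∀ {n} (f : Vector ℚ n) → ℚ.∣ ∑ f ∣ ℚ.≤ ∑ (λ i → ℚ.∣ f i ∣)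
∣∑∣≤∑∣∣ {zero}  f = ℚ.≤-refl
∣∑∣≤∑∣∣ {suc n} f = ℚ.≤-trans (ℚ.∣p+q∣≤∣p∣+∣q∣ (f zero) (∑ (λ i → f (suc i))))
  (ℚ.+-monoʳ-≤ ℚ.∣ f zero ∣ (∣∑∣≤∑∣∣ (λ i → f (suc i))))

indicator : Bool → ℚ
indicator b = if b then 1ℚ else 0ℚ

-- The rational adjacency matrix, of which adjacencyMatrix is the constant embedding in ℝ.
entry : ∀ {n} → Graph n → Fin n → Fin n → ℚ
entry G i j = indicator (adj G i j)

0≤indicator : ∀ b → 0ℚ ℚ.≤ indicator b
0≤indicator true  = 0≤1
0≤indicator false = ℚ.≤-refl

∣indicator∣ : ∀ b → ℚ.∣ indicator b ∣ ≡ indicator b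
∣indicator∣ b = ℚ.0≤p⇒∣p∣≡p (0≤indicator b)

seq-∑ℝ : ∀ {n} (x : Vector ℝ n) k → seq (∑ℝ x) k ≡ ∑ (λ i → seq (x i) k)
seq-∑ℝ {zero}  x k = refl
seq-∑ℝ {suc n} x k = cong (seq (x zero) k ℚ.+_) (seq-∑ℝ (λ i → x (suc i)) k)

-- Real arithmetic is pointwise on sequences, so at each index a row of the real
-- matrix product is a rational sum.
seq-row : ∀ {n} (G : Graph n) (x : Vector ℝ n) i k →
          seq ((adjacencyMatrix G *ᵥ x) i) k ≡ ∑ (λ j → entry G i j ℚ.* seq (x j) k)
seq-row G x i k = trans (seq-∑ℝ (λ j → adjacencyMatrix G i j * x j) k)
  (∑ℚ.sum-cong-≗ (λ j → cong (ℚ._* seq (x j) k) (seq-if (adj G i j))))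
  where
  seq-if : ∀ b → seq (if b then 1ℝ else 0ℝ) k ≡ indicator b
  seq-if true  = refl
  seq-if false = refl

eventually-all : ∀ {n} {P : Fin n → ℕ → Set} →
  (∀ i → ∃[ N ] (∀ k → N ℕ.≤ k → P i k)) → ∃[ N ] (∀ k → N ℕ.≤ k → ∀ i → P i k)
eventually-all {zero}  ev = 0 , λ _ _ ()
eventually-all {suc n} ev =
  let N , here = ev zero
      M , there = eventually-all (λ i → ev (suc i))
  in N ℕ.⊔ M , λ where
    k k≥ zero    → here k (ℕ.m⊔n≤o⇒m≤o N M k≥)
    k k≥ (suc i) → there k (ℕ.m⊔n≤o⇒n≤o N M k≥) i

-- Here x holds the moduli of an approximate eigenvector, M that of its eigenvalue.
-- Pairing with the weights w gives M (w , x) ≤ ε Σ w + (w , A x), and by symmetry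
-- (w , A x) = (A w , x) ≤ Λ (w , x).
weighted-bound : ∀ {n} (G : Graph n) (w x : Vector ℚ n) {M Λ g ε} →
  (∀ i → 0ℚ ℚ.≤ w i) → (∀ i → 0ℚ ℚ.≤ x i) →
  (∀ i → ∑ (λ j → entry G i j ℚ.* w j) ℚ.≤ Λ ℚ.* w i) →
  (∀ i → M ℚ.* x i ℚ.≤ ε ℚ.+ ∑ (λ j → entry G i j ℚ.* x j)) →
  Λ ℚ.+ g ℚ.≤ M →
  g ℚ.* ∑ (λ i → w i ℚ.* x i) ℚ.≤ ε ℚ.* ∑ w
weighted-bound G w x {M} {Λ} {g} {ε} 0≤w 0≤x Aw≤Λw Mx≤ Λ+g≤M =
  cancel (ℚ.≤-trans (ℚ.*-monoʳ-≤-nonNeg (∑ wx) {{ℚ.nonNegative 0≤∑wx}} Λ+g≤M) upper)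
  where
  open ℚ.≤-Reasoning
  wx : Vector ℚ _
  wx i = w i ℚ.* x i
  0≤∑wx : 0ℚ ℚ.≤ ∑ wx
  0≤∑wx = 0≤∑ (λ i → 0≤* (0≤w i) (0≤x i))

  transpose : ∑ (λ i → w i ℚ.* ∑ (λ j → entry G i j ℚ.* x j)) ≡
              ∑ (λ j → x j ℚ.* ∑ (λ i → entry G j i ℚ.* w i))
  transpose = begin-equality
    ∑ (λ i → w i ℚ.* ∑ (λ j → entry G i j ℚ.* x j))
      ≡⟨ ∑ℚ.sum-cong-≗ (λ i → ∑ℚ.*-distribˡ-sum (w i) (λ j → entry G i j ℚ.* x j)) ⟩
    ∑ (λ i → ∑ (λ j → w i ℚ.* (entry G i j ℚ.* x j)))
      ≡⟨ ∑ℚ.∑-comm (λ i j → w i ℚ.* (entry G i j ℚ.* x j)) ⟩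
    ∑ (λ j → ∑ (λ i → w i ℚ.* (entry G i j ℚ.* x j)))
      ≡⟨ ∑ℚ.sum-cong-≗ (λ j → ∑ℚ.sum-cong-≗ (λ i → swap i j)) ⟩
    ∑ (λ j → ∑ (λ i → x j ℚ.* (entry G j i ℚ.* w i)))
      ≡⟨ ∑ℚ.sum-cong-≗ (λ j → ∑ℚ.*-distribˡ-sum (x j) (λ i → entry G j i ℚ.* w i)) ⟨
    ∑ (λ j → x j ℚ.* ∑ (λ i → entry G j i ℚ.* w i)) ∎
    where
    open +-*-Solver
    swap : ∀ i j → w i ℚ.* (entry G i j ℚ.* x j) ≡ x j ℚ.* (entry G j i ℚ.* w i)
    swap i j rewrite symm G i j =
      solve 3 (λ w e x → w :* (e :* x) := x :* (e :* w)) refl (w i) (entry G j i) (x j)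

  upper : M ℚ.* ∑ wx ℚ.≤ ε ℚ.* ∑ w ℚ.+ Λ ℚ.* ∑ wx
  upper = begin
    M ℚ.* ∑ wx
      ≡⟨ ∑ℚ.*-distribˡ-sum M wx ⟩
    ∑ (λ i → M ℚ.* (w i ℚ.* x i))
      ≡⟨ ∑ℚ.sum-cong-≗ (λ i → exchange M (w i) (x i)) ⟩
    ∑ (λ i → w i ℚ.* (M ℚ.* x i))
      ≤⟨ ∑-mono (λ i → *-monoˡ-0≤ (w i) (0≤w i) (Mx≤ i)) ⟩
    ∑ (λ i → w i ℚ.* (ε ℚ.+ ∑ (λ j → entry G i j ℚ.* x j)))
      ≡⟨ ∑ℚ.sum-cong-≗ (λ i → expand (w i) ε _) ⟩
    ∑ (λ i → ε ℚ.* w i ℚ.+ w i ℚ.* ∑ (λ j → entry G i j ℚ.* x j))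
      ≡⟨ ∑ℚ.∑-distrib-+ (λ i → ε ℚ.* w i) (λ i → w i ℚ.* ∑ (λ j → entry G i j ℚ.* x j)) ⟩
    ∑ (λ i → ε ℚ.* w i) ℚ.+ ∑ (λ i → w i ℚ.* ∑ (λ j → entry G i j ℚ.* x j))
      ≡⟨ cong₂ ℚ._+_ (sym (∑ℚ.*-distribˡ-sum ε w)) transpose ⟩
    ε ℚ.* ∑ w ℚ.+ ∑ (λ j → x j ℚ.* ∑ (λ i → entry G j i ℚ.* w i))
      ≤⟨ ℚ.+-monoʳ-≤ (ε ℚ.* ∑ w) (∑-mono (λ j → *-monoˡ-0≤ (x j) (0≤x j) (Aw≤Λw j))) ⟩
    ε ℚ.* ∑ w ℚ.+ ∑ (λ j → x j ℚ.* (Λ ℚ.* w j))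
      ≡⟨ cong (ε ℚ.* ∑ w ℚ.+_) (∑ℚ.sum-cong-≗ (λ j → rotate (x j) Λ (w j))) ⟩
    ε ℚ.* ∑ w ℚ.+ ∑ (λ j → Λ ℚ.* (w j ℚ.* x j))
      ≡⟨ cong (ε ℚ.* ∑ w ℚ.+_) (∑ℚ.*-distribˡ-sum Λ wx) ⟨
    ε ℚ.* ∑ w ℚ.+ Λ ℚ.* ∑ wx ∎
    where
    open +-*-Solver
    exchange : ∀ a b c → a ℚ.* (b ℚ.* c) ≡ b ℚ.* (a ℚ.* c)
    exchange = solve 3 (λ a b c → a :* (b :* c) := b :* (a :* c)) refl
    expand : ∀ a b c → a ℚ.* (b ℚ.+ c) ≡ b ℚ.* a ℚ.+ a ℚ.* c
    expand = solve 3 (λ a b c → a :* (b :+ c) := b :* a :+ a :* c) refl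
    rotate : ∀ a b c → a ℚ.* (b ℚ.* c) ≡ b ℚ.* (c ℚ.* a)
    rotate = solve 3 (λ a b c → a :* (b :* c) := b :* (c :* a)) refl

  cancel : ∀ {S E} → (Λ ℚ.+ g) ℚ.* S ℚ.≤ E ℚ.+ Λ ℚ.* S → g ℚ.* S ℚ.≤ E
  cancel {S} {E} le = ≤-by _ (0≤- le)
    (solve 4 (λ Λ g S E → g :* S :+ (E :+ Λ :* S :+ :- ((Λ :+ g) :* S)) := E) refl Λ g S E)
    where open +-*-Solver

p≤∣p∣ : ∀ p → p ℚ.≤ ℚ.∣ p ∣
p≤∣p∣ p with ℚ.∣p∣≡p∨∣p∣≡-p p | ℚ.≤-total 0ℚ p
... | _ | inj₁ 0≤p = ℚ.≤-reflexive (sym (ℚ.0≤p⇒∣p∣≡p 0≤p))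
... | _ | inj₂ p≤0 = ℚ.≤-trans p≤0 (ℚ.0≤∣p∣ p)

#0⇒∣∣≥ : ∀ {x} → x # 0ℝ →
  ∃[ h ] (0ℚ ℚ.< h × ∃[ N ] (∀ k → N ℕ.≤ k → h ℚ.≤ ℚ.∣ seq x k ∣))
#0⇒∣∣≥ {x} (inj₁ (mk< h 0<h (N , gap))) = h , 0<h , N , λ k k≥ →
  ℚ.≤-trans (≤-by _ (0≤- (gap k k≥)) (lemma h (seq x k)))
    (subst (ℚ.- seq x k ℚ.≤_) (ℚ.∣-p∣≡∣p∣ (seq x k)) (p≤∣p∣ (ℚ.- seq x k)))
  where
  open +-*-Solver
  lemma : ∀ h p → h ℚ.+ (0ℚ ℚ.- (p ℚ.+ h)) ≡ ℚ.- p
  lemma = solve 2 (λ h p → h :+ (con 0ℚ :+ :- (p :+ h)) := :- p) refl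
#0⇒∣∣≥ {x} (inj₂ (mk< h 0<h (N , gap))) = h , 0<h , N , λ k k≥ →
  ℚ.≤-trans (subst (ℚ._≤ seq x k) (ℚ.+-identityˡ h) (gap k k≥)) (p≤∣p∣ (seq x k))

-- The Collatz–Wielandt bound: a positive vector w with A w ≤ Λ w bounds the modulus
-- of every eigenvalue of A by Λ.
∣eigenvalue∣≤ : ∀ {n} (G : Graph n) (w : Vector ℚ n) (Λ : ℚ) →
  (∀ i → 0ℚ ℚ.< w i) → (∀ i → ∑ (λ j → entry G i j ℚ.* w j) ℚ.≤ Λ ℚ.* w i) →
  ∀ μ → IsEigenvalue (adjacencyMatrix G) μ → ∣ μ ∣ ≤ fromℚ Λ
∣eigenvalue∣≤ {n} G w Λ 0<w Aw≤Λw μ (x , (i₀ , xi₀#0) , Ax≈μx) (mk< g 0<g (N₁ , gap)) =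
  go (#0⇒∣∣≥ xi₀#0)
  where
  0≤w : ∀ i → 0ℚ ℚ.≤ w i
  0≤w i = ℚ.<⇒≤ (0<w i)

  -- With h a lower bound for the i₀-th entry and g the gap between Λ and the modulus
  -- of μ, the previous lemma gives g w(i₀) h ≤ ε Σ w, so half of g w(i₀) h is a
  -- contradictory value of ε Σ w.
  absurd : ∀ {h ε k} → 0ℚ ℚ.< h → h ℚ.≤ ℚ.∣ seq (x i₀) k ∣ →
           Λ ℚ.+ g ℚ.≤ ℚ.∣ seq μ k ∣ →
           (∀ i → ℚ.∣ seq ((adjacencyMatrix G *ᵥ x) i) k ℚ.- seq (μ * x i) k ∣ ℚ.≤ ε) →
           ¬ (∑ w ℚ.* ε ≡ ½ ℚ.* (g ℚ.* (w i₀ ℚ.* h)))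
  absurd {h} {ε} {k} 0<h h≤ Λ+g≤ close eq = ℚ.<-irrefl refl (begin-strict
    g ℚ.* (w i₀ ℚ.* h)
      ≤⟨ *-monoˡ-0≤ g (ℚ.<⇒≤ 0<g) (*-monoˡ-0≤ (w i₀) (0≤w i₀) h≤) ⟩
    g ℚ.* (w i₀ ℚ.* X i₀)
      ≤⟨ *-monoˡ-0≤ g (ℚ.<⇒≤ 0<g) (term≤∑ (λ i → 0≤* (0≤w i) (ℚ.0≤∣p∣ (seq (x i) k))) i₀) ⟩
    g ℚ.* ∑ (λ i → w i ℚ.* X i)
      ≤⟨ weighted-bound G w X {Λ = Λ} {g} {ε} 0≤w (λ i → ℚ.0≤∣p∣ (seq (x i) k)) Aw≤Λw M*X≤ Λ+g≤ ⟩
    ε ℚ.* ∑ w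
      ≡⟨ trans (ℚ.*-comm ε (∑ w)) eq ⟩
    ½ ℚ.* c
      <⟨ subst (½ ℚ.* c ℚ.<_) (half+half c)
           (subst (ℚ._< ½ ℚ.* c ℚ.+ ½ ℚ.* c) (ℚ.+-identityˡ (½ ℚ.* c))
             (ℚ.+-monoˡ-< (½ ℚ.* c) (half-pos 0<c))) ⟩
    c ∎)
    where
    open ℚ.≤-Reasoning
    c : ℚ
    c = g ℚ.* (w i₀ ℚ.* h)
    0<c : 0ℚ ℚ.< c
    0<c = 0<* 0<g (0<* (0<w i₀) 0<h)
    X : Vector ℚ n
    X i = ℚ.∣ seq (x i) k ∣
    M*X≤ : ∀ i → ℚ.∣ seq μ k ∣ ℚ.* X i ℚ.≤ ε ℚ.+ ∑ (λ j → entry G i j ℚ.* X j)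
    M*X≤ i = begin
      ℚ.∣ seq μ k ∣ ℚ.* X i
        ≡⟨ ℚ.∣p*q∣≡∣p∣*∣q∣ (seq μ k) (seq (x i) k) ⟨
      ℚ.∣ seq (μ * x i) k ∣
        ≤⟨ ∣p∣≤∣p-q∣+∣q∣ (seq (μ * x i) k) Axᵢ ⟩
      ℚ.∣ seq (μ * x i) k ℚ.- Axᵢ ∣ ℚ.+ ℚ.∣ Axᵢ ∣
        ≡⟨ cong (ℚ._+ ℚ.∣ Axᵢ ∣) (∣-∣-sym (seq (μ * x i) k) Axᵢ) ⟩
      ℚ.∣ Axᵢ ℚ.- seq (μ * x i) k ∣ ℚ.+ ℚ.∣ Axᵢ ∣
        ≤⟨ ℚ.+-mono-≤ (close i) (ℚ.≤-trans
             (ℚ.≤-reflexive (cong ℚ.∣_∣ (seq-row G x i k)))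
             (∣∑∣≤∑∣∣ (λ j → entry G i j ℚ.* seq (x j) k))) ⟩
      ε ℚ.+ ∑ (λ j → ℚ.∣ entry G i j ℚ.* seq (x j) k ∣)
        ≡⟨ cong (ε ℚ.+_) (∑ℚ.sum-cong-≗ (λ j →
             trans (ℚ.∣p*q∣≡∣p∣*∣q∣ (entry G i j) (seq (x j) k))
                   (cong (ℚ._* X j) (∣indicator∣ (adj G i j))))) ⟩
      ε ℚ.+ ∑ (λ j → entry G i j ℚ.* X j) ∎
      where
      Axᵢ : ℚ
      Axᵢ = seq ((adjacencyMatrix G *ᵥ x) i) k

  go : ¬ (∃[ h ] (0ℚ ℚ.< h × ∃[ N ] (∀ k → N ℕ.≤ k → h ℚ.≤ ℚ.∣ seq (x i₀) k ∣)))
  go (h , 0<h , N₂ , h≤) = choose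
    (divide (ℚ.<-≤-trans (0<w i₀) (term≤∑ 0≤w i₀)) (half-pos (0<* 0<g (0<* (0<w i₀) 0<h))))
    where
    choose : ¬ (∃[ ε ] (0ℚ ℚ.< ε × ∑ w ℚ.* ε ≡ ½ ℚ.* (g ℚ.* (w i₀ ℚ.* h))))
    choose (ε , 0<ε , eq) = at (eventually-all (λ i → _≈_.close (Ax≈μx i) ε 0<ε))
      where
      at : ¬ (∃[ N ] (∀ k → N ℕ.≤ k → ∀ i →
             ℚ.∣ seq ((adjacencyMatrix G *ᵥ x) i) k ℚ.- seq (μ * x i) k ∣ ℚ.≤ ε))
      at (N₃ , close) = absurd 0<h
        (h≤ k (ℕ.≤-trans (ℕ.m≤n⊔m N₁ N₂) (ℕ.m≤m⊔n (N₁ ℕ.⊔ N₂) N₃)))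
        (gap k (ℕ.≤-trans (ℕ.m≤m⊔n N₁ N₂) (ℕ.m≤m⊔n (N₁ ℕ.⊔ N₂) N₃)))
        (close k (ℕ.m≤n⊔m (N₁ ℕ.⊔ N₂) N₃)) eq
        where
        k : ℕ
        k = (N₁ ℕ.⊔ N₂) ℕ.⊔ N₃

-- The pineapple graph and its 4-cycles

-- Adjacency among the vertices other than the hub: the first s of them form a
-- clique, and the others have no neighbours among them.
cliqueAdj : ∀ {n} → ℕ → Fin n → Fin n → Bool
cliqueAdj s i j = (toℕ i <ᵇ s) ∧ (toℕ j <ᵇ s) ∧ not (toℕ i ≡ᵇ toℕ j)

pineappleAdj : ∀ {n} → ℕ → Fin (suc n) → Fin (suc n) → Bool
pineappleAdj s zero    zero    = false
pineappleAdj s zero    (suc j) = true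
pineappleAdj s (suc i) zero    = true
pineappleAdj s (suc i) (suc j) = cliqueAdj s i j

≡ᵇ-sym : ∀ m n → (m ≡ᵇ n) ≡ (n ≡ᵇ m)
≡ᵇ-sym zero    zero    = refl
≡ᵇ-sym zero    (suc n) = refl
≡ᵇ-sym (suc m) zero    = refl
≡ᵇ-sym (suc m) (suc n) = ≡ᵇ-sym m n

≡ᵇ-refl : ∀ n → (n ≡ᵇ n) ≡ true
≡ᵇ-refl zero    = refl
≡ᵇ-refl (suc n) = ≡ᵇ-refl n

∧-swap : ∀ a b c → a ∧ b ∧ c ≡ b ∧ a ∧ c
∧-swap true  b c = refl
∧-swap false b c = sym (∧-zeroʳ b)

cliqueAdj-sym : ∀ {n} s (i j : Fin n) → cliqueAdj s i j ≡ cliqueAdj s j i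
cliqueAdj-sym s i j rewrite ≡ᵇ-sym (toℕ i) (toℕ j) =
  ∧-swap (toℕ i <ᵇ s) (toℕ j <ᵇ s) (not (toℕ j ≡ᵇ toℕ i))

cliqueAdj-irrefl : ∀ {n} s (i : Fin n) → cliqueAdj s i i ≡ false
cliqueAdj-irrefl s i rewrite ≡ᵇ-refl (toℕ i)
  | ∧-zeroʳ (toℕ i <ᵇ s) = ∧-zeroʳ (toℕ i <ᵇ s)

-- The pineapple graph: a clique on s + 1 vertices, one of which, the hub, also
-- carries q pendant edges.  Vertex 0 is the hub, vertices 1 , … , s are the rest of
-- the clique and the last q vertices are the leaves.
pineapple : ∀ s q → Graph (suc (s ℕ.+ q))
pineapple s q = record
  { adj    = pineappleAdj s
  ; symm   = λ where
      zero    zero    → refl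
      zero    (suc j) → refl
      (suc i) zero    → refl
      (suc i) (suc j) → cliqueAdj-sym s i j
  ; irrefl = λ where
      zero    → refl
      (suc i) → cliqueAdj-irrefl s i
  }

module Σℕ = Sum ℕ.+-*-semiring

∑ℕ-zero : ∀ {n} {f : Vector ℕ n} → (∀ i → f i ≡ 0) → ∑ℕ f ≡ 0
∑ℕ-zero {zero}  f≡0 = refl
∑ℕ-zero {suc n} f≡0 = cong₂ ℕ._+_ (f≡0 zero) (∑ℕ-zero (λ i → f≡0 (suc i)))

∑ℕ-one : ∀ n → ∑ℕ {n} (λ _ → 1) ≡ n
∑ℕ-one zero    = refl
∑ℕ-one (suc n) = cong suc (∑ℕ-one n)

∑ℕ-mono : ∀ {n} {f g : Vector ℕ n} → (∀ i → f i ℕ.≤ g i) → ∑ℕ f ℕ.≤ ∑ℕ g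
∑ℕ-mono {zero}  f≤g = z≤n
∑ℕ-mono {suc n} f≤g = ℕ.+-mono-≤ (f≤g zero) (∑ℕ-mono (λ i → f≤g (suc i)))

-- A vanishing first term can be dropped from a sum.
drop-zero-≤ : ∀ {n x} {f g : Vector ℕ n} →
  x ≡ 0 → (∀ i → f i ℕ.≤ g i) → x ℕ.+ ∑ℕ f ℕ.≤ ∑ℕ g
drop-zero-≤ x≡0 f≤g = ℕ.+-mono-≤ (ℕ.≤-reflexive x≡0) (∑ℕ-mono f≤g)

pascal : ∀ n k → n C k ℕ.+ n C suc k ≡ suc n C suc k
pascal = nCk+nC[k+1]≡[n+1]C[k+1]

∑[<] : ∀ s q → ∑ℕ {s ℕ.+ q} (λ j → [ toℕ j <ᵇ s ]) ≡ s
∑[<] zero    q = ∑ℕ-zero {q} (λ _ → refl)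
∑[<] (suc s) q = cong suc (∑[<] s q)

cliqueEdges : ∀ s q →
  (∑ℕ {s ℕ.+ q} λ i → ∑ℕ {s ℕ.+ q} λ j → [ i <ᶠ j ∧ cliqueAdj s i j ]) ≡ s C 2
cliqueEdges zero q = ∑ℕ-zero {q} (λ i → ∑ℕ-zero {q} (λ j → cong [_] (∧-zeroʳ (i <ᶠ j))))
cliqueEdges (suc s) q = trans
  (cong₂ ℕ._+_
    (trans (Σℕ.sum-cong-≗ {s ℕ.+ q} (λ j → cong [_] (∧-identityʳ (toℕ j <ᵇ s)))) (∑[<] s q))
    (cliqueEdges s q))
  (trans (cong (ℕ._+ s C 2) (sym (nC1≡n s))) (pascal s 1))

#edges-pineapple : ∀ s q → #edges (pineapple s q) ≡ suc s C 2 ℕ.+ q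
#edges-pineapple s q = begin
  ∑ℕ {s ℕ.+ q} (λ _ → 1) ℕ.+ _   ≡⟨ cong₂ ℕ._+_ (∑ℕ-one (s ℕ.+ q)) (cliqueEdges s q) ⟩
  (s ℕ.+ q) ℕ.+ s C 2            ≡⟨ solve 3 (λ s q c → (s :+ q) :+ c := (s :+ c) :+ q) refl s q (s C 2) ⟩
  (s ℕ.+ s C 2) ℕ.+ q            ≡⟨ cong (λ t → (t ℕ.+ s C 2) ℕ.+ q) (nC1≡n s) ⟨
  (s C 1 ℕ.+ s C 2) ℕ.+ q        ≡⟨ cong (ℕ._+ q) (pascal s 1) ⟩
  suc s C 2 ℕ.+ q                ∎
  where open ≡-Reasoning
        open ℕ.+-*-Solver

-- The counts below are bounded above by splitting off vertex 0 from every summation.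
-- The number n of vertices is arbitrary: only the first s of them matter.

count-< : ∀ n s → ∑ℕ {n} (λ j → [ toℕ j <ᵇ s ]) ℕ.≤ s
count-< zero    s       = z≤n
count-< (suc n) zero    = ℕ.≤-reflexive (∑ℕ-zero {suc n} (λ _ → refl))
count-< (suc n) (suc s) = ℕ.s≤s (count-< n s)

#edges-clique : ∀ n s →
  (∑ℕ {n} λ b → ∑ℕ {n} λ d → [ b <ᶠ d ∧ (toℕ b <ᵇ s) ∧ (toℕ d <ᵇ s) ]) ℕ.≤ s C 2
#edges-clique zero    s    = z≤n
#edges-clique (suc n) zero = ℕ.≤-reflexive
  (∑ℕ-zero {suc n} (λ b → ∑ℕ-zero {suc n} (λ d → cong [_] (∧-zeroʳ (b <ᶠ d)))))
#edges-clique (suc n) (suc s) = begin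
  _                ≤⟨ ℕ.+-mono-≤ (count-< n s) (#edges-clique n s) ⟩
  s ℕ.+ s C 2      ≡⟨ cong (ℕ._+ s C 2) (nC1≡n s) ⟨
  s C 1 ℕ.+ s C 2  ≡⟨ pascal s 1 ⟩
  suc s C 2        ∎
  where open ℕ.≤-Reasoning

-- Ordered pairs of distinct clique vertices.
#arcs-clique : ∀ n s →
  (∑ℕ {n} λ c → ∑ℕ {n} λ d → [ cliqueAdj s c d ]) ℕ.≤ 2 ℕ.* (s C 2)
#arcs-clique zero    s    = z≤n
#arcs-clique (suc n) zero = ℕ.≤-reflexive
  (∑ℕ-zero {suc n} (λ c → ∑ℕ-zero {suc n} (λ d → refl)))
#arcs-clique (suc n) (suc s) = begin
  _
    ≤⟨ ℕ.+-mono-≤ (∑ℕ-mono {n} (λ j → [∧true] (toℕ j <ᵇ s)))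
         (ℕ.≤-trans
           (ℕ.≤-reflexive (Σℕ.∑-distrib-+ {n} (λ c → [ (toℕ c <ᵇ s) ∧ true ]) _))
           (ℕ.+-mono-≤ (∑ℕ-mono {n} (λ j → [∧true] (toℕ j <ᵇ s))) (#arcs-clique n s))) ⟩
  ∑ℕ {n} (λ j → [ toℕ j <ᵇ s ]) ℕ.+ (∑ℕ {n} (λ j → [ toℕ j <ᵇ s ]) ℕ.+ 2 ℕ.* (s C 2))
    ≤⟨ ℕ.+-mono-≤ (count-< n s) (ℕ.+-monoˡ-≤ (2 ℕ.* (s C 2)) (count-< n s)) ⟩
  s ℕ.+ (s ℕ.+ 2 ℕ.* (s C 2))
    ≡⟨ cong (λ t → t ℕ.+ (t ℕ.+ 2 ℕ.* (s C 2))) (nC1≡n s) ⟨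
  s C 1 ℕ.+ (s C 1 ℕ.+ 2 ℕ.* (s C 2))
    ≡⟨ solve 2 (λ x y → x :+ (x :+ con 2 :* y) := con 2 :* (x :+ y)) refl (s C 1) (s C 2) ⟩
  2 ℕ.* (s C 1 ℕ.+ s C 2)
    ≡⟨ cong (2 ℕ.*_) (pascal s 1) ⟩
  2 ℕ.* (suc s C 2) ∎
  where
  open ℕ.≤-Reasoning
  open ℕ.+-*-Solver
  [∧true] : ∀ b → [ b ∧ true ] ℕ.≤ [ b ]
  [∧true] b = ℕ.≤-reflexive (cong [_] (∧-identityʳ b))

-- Paths b – c – d with b < d in a clique on s vertices; they complete to 4-cycles
-- through any further vertex adjacent to b and d.
#paths-clique : ∀ n s →
  (∑ℕ {n} λ b → ∑ℕ {n} λ c → ∑ℕ {n} λ d → [ b <ᶠ d ∧ cliqueAdj s b c ∧ cliqueAdj s c d ])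
  ℕ.≤ 3 ℕ.* (s C 3)
#paths-clique zero    s    = z≤n
#paths-clique (suc n) zero = ℕ.≤-reflexive (∑ℕ-zero {suc n} (λ b → ∑ℕ-zero {suc n} (λ c →
  ∑ℕ-zero {suc n} (λ d → cong [_] (∧-zeroʳ (b <ᶠ d))))))
#paths-clique (suc n) (suc s) = begin
  _
    ≤⟨ ℕ.+-mono-≤ b=0 (ℕ.≤-trans (ℕ.≤-reflexive (Σℕ.∑-distrib-+ {n} _ _))
         (ℕ.+-mono-≤ b>0∧c=0 b>0∧c>0)) ⟩
  2 ℕ.* (s C 2) ℕ.+ (s C 2 ℕ.+ 3 ℕ.* (s C 3))
    ≡⟨ solve 2 (λ x y → con 2 :* x :+ (x :+ con 3 :* y) := con 3 :* (x :+ y)) refl (s C 2) (s C 3) ⟩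
  3 ℕ.* (s C 2 ℕ.+ s C 3)
    ≡⟨ cong (3 ℕ.*_) (pascal s 2) ⟩
  3 ℕ.* (suc s C 3) ∎
  where
  open ℕ.≤-Reasoning
  open ℕ.+-*-Solver
  b=0 : (∑ℕ {suc n} λ c → ∑ℕ {suc n} λ d →
            [ zero {n} <ᶠ d ∧ cliqueAdj (suc s) (zero {n}) c ∧ cliqueAdj (suc s) c d ])
          ℕ.≤ 2 ℕ.* (s C 2)
  b=0 = ℕ.≤-trans
    (drop-zero-≤ {n} (∑ℕ-zero {n} (λ d → refl))
      (λ c → drop-zero-≤ {n} refl (λ d → absorb (toℕ c <ᵇ s) (toℕ d <ᵇ s) (not (toℕ c ≡ᵇ toℕ d)))))
    (#arcs-clique n s)
    where
    absorb : ∀ x y z → [ (x ∧ true) ∧ x ∧ y ∧ z ] ℕ.≤ [ x ∧ y ∧ z ]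
    absorb true  y z = ℕ.≤-refl
    absorb false y z = z≤n
  b>0∧c=0 : (∑ℕ {n} λ b → ∑ℕ {suc n} λ d →
             [ suc b <ᶠ d ∧ cliqueAdj (suc s) (suc b) (zero {n}) ∧ cliqueAdj (suc s) (zero {n}) d ])
           ℕ.≤ s C 2
  b>0∧c=0 = ℕ.≤-trans
    (∑ℕ-mono {n} (λ b → drop-zero-≤ {n} refl (λ d → absorb (b <ᶠ d) (toℕ b <ᵇ s) (toℕ d <ᵇ s))))
    (#edges-clique n s)
    where
    absorb : ∀ x y z → [ x ∧ (y ∧ true) ∧ z ∧ true ] ℕ.≤ [ x ∧ y ∧ z ]
    absorb x true  z = ℕ.≤-reflexive (cong (λ t → [ x ∧ t ]) (∧-identityʳ z))
    absorb x false z = ℕ.≤-refl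
  b>0∧c>0 : (∑ℕ {n} λ b → ∑ℕ {n} λ c → ∑ℕ {suc n} λ d →
           [ suc b <ᶠ d ∧ cliqueAdj s b c ∧ cliqueAdj (suc s) (suc c) d ])
         ℕ.≤ 3 ℕ.* (s C 3)
  b>0∧c>0 = ℕ.≤-trans
    (∑ℕ-mono {n} (λ b → ∑ℕ-mono {n} (λ c → drop-zero-≤ {n} refl (λ d → ℕ.≤-refl))))
    (#paths-clique n s)

no-cycle : ∀ x y → [ x ∧ y ∧ false ] ≡ 0
no-cycle false y     = refl
no-cycle true  false = refl
no-cycle true  true  = refl

#C₄-clique : ∀ n s →
  (∑ℕ {n} λ a → ∑ℕ {n} λ b → ∑ℕ {n} λ c → ∑ℕ {n} λ d →
    [ a <ᶠ b ∧ a <ᶠ c ∧ b <ᶠ d ∧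
      cliqueAdj s a b ∧ cliqueAdj s b c ∧ cliqueAdj s c d ∧ cliqueAdj s d a ])
  ℕ.≤ 3 ℕ.* (s C 4)
#C₄-clique zero    s    = z≤n
#C₄-clique (suc n) zero = ℕ.≤-reflexive (∑ℕ-zero {suc n} (λ a → ∑ℕ-zero {suc n} (λ b →
  ∑ℕ-zero {suc n} (λ c → ∑ℕ-zero {suc n} (λ d → vanish (a <ᶠ b) (a <ᶠ c) (b <ᶠ d))))))
  where
  vanish : ∀ x y z → [ x ∧ y ∧ z ∧ false ] ≡ 0
  vanish false y     z     = refl
  vanish true  false z     = refl
  vanish true  true  false = refl
  vanish true  true  true  = refl
#C₄-clique (suc n) (suc s) = begin
  _                                  ≤⟨ ℕ.+-mono-≤ a=0 a>0 ⟩
  3 ℕ.* (s C 3) ℕ.+ 3 ℕ.* (s C 4)    ≡⟨ ℕ.*-distribˡ-+ 3 (s C 3) (s C 4) ⟨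
  3 ℕ.* (s C 3 ℕ.+ s C 4)            ≡⟨ cong (3 ℕ.*_) (pascal s 3) ⟩
  3 ℕ.* (suc s C 4)                  ∎
  where
  open ℕ.≤-Reasoning
  a=0 : (∑ℕ {suc n} λ b → ∑ℕ {suc n} λ c → ∑ℕ {suc n} λ d →
            [ zero {n} <ᶠ b ∧ zero {n} <ᶠ c ∧ b <ᶠ d ∧ cliqueAdj (suc s) (zero {n}) b ∧
              cliqueAdj (suc s) b c ∧ cliqueAdj (suc s) c d ∧ cliqueAdj (suc s) d (zero {n}) ])
          ℕ.≤ 3 ℕ.* (s C 3)
  a=0 = ℕ.≤-trans
    (drop-zero-≤ {n} (∑ℕ-zero {suc n} (λ c → ∑ℕ-zero {suc n} (λ d → refl)))
      (λ b → drop-zero-≤ {n} (∑ℕ-zero {suc n} (λ d → refl))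
        (λ c → drop-zero-≤ {n} refl
          (λ d → forget (b <ᶠ d) ((toℕ b <ᵇ s) ∧ true) (cliqueAdj s b c) (cliqueAdj s c d) ((toℕ d <ᵇ s) ∧ true)))))
    (#paths-clique n s)
    where
    forget : ∀ x p y z r → [ x ∧ p ∧ y ∧ z ∧ r ] ℕ.≤ [ x ∧ y ∧ z ]
    forget false p     y     z     r     = z≤n
    forget true  false y     z     r     = z≤n
    forget true  true  false z     r     = z≤n
    forget true  true  true  false r     = z≤n
    forget true  true  true  true  false = z≤n
    forget true  true  true  true  true  = ℕ.≤-refl
  a>0 : (∑ℕ {n} λ a → ∑ℕ {suc n} λ b → ∑ℕ {suc n} λ c → ∑ℕ {suc n} λ d →
           [ suc a <ᶠ b ∧ suc a <ᶠ c ∧ b <ᶠ d ∧ cliqueAdj (suc s) (suc a) b ∧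
             cliqueAdj (suc s) b c ∧ cliqueAdj (suc s) c d ∧ cliqueAdj (suc s) d (suc a) ])
         ℕ.≤ 3 ℕ.* (s C 4)
  a>0 = ℕ.≤-trans
    (∑ℕ-mono {n} (λ a → drop-zero-≤ {n} (∑ℕ-zero {suc n} (λ c → ∑ℕ-zero {suc n} (λ d → refl)))
      (λ b → drop-zero-≤ {n} (∑ℕ-zero {suc n} (λ d → cong [_] (∧-zeroʳ (a <ᶠ b))))
        (λ c → drop-zero-≤ {n} (no-cycle (a <ᶠ b) (a <ᶠ c)) (λ d → ℕ.≤-refl)))))
    (#C₄-clique n s)

-- A leaf lies on no cycle, so only the 3 (s+1 choose 4) cycles of the clique remain:
-- those through the hub are counted by the paths joining two of its neighbours.
#C₄-pineapple : ∀ s q → #C₄ (pineapple s q) ℕ.≤ 3 ℕ.* (suc s C 4)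
#C₄-pineapple s q = begin
  _                                  ≤⟨ ℕ.+-mono-≤ a=0 a>0 ⟩
  3 ℕ.* (s C 3) ℕ.+ 3 ℕ.* (s C 4)    ≡⟨ ℕ.*-distribˡ-+ 3 (s C 3) (s C 4) ⟨
  3 ℕ.* (s C 3 ℕ.+ s C 4)            ≡⟨ cong (3 ℕ.*_) (pascal s 3) ⟩
  3 ℕ.* (suc s C 4)                  ∎
  where
  open ℕ.≤-Reasoning
  n : ℕ
  n = s ℕ.+ q
  adjacent : Fin (suc n) → Fin (suc n) → Bool
  adjacent = pineappleAdj s
  a=0 : (∑ℕ {suc n} λ b → ∑ℕ {suc n} λ c → ∑ℕ {suc n} λ d →
            [ zero {n} <ᶠ b ∧ zero {n} <ᶠ c ∧ b <ᶠ d ∧ adjacent zero b ∧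
              adjacent b c ∧ adjacent c d ∧ adjacent d zero ])
          ℕ.≤ 3 ℕ.* (s C 3)
  a=0 = ℕ.≤-trans
    (drop-zero-≤ {n} (∑ℕ-zero {suc n} (λ c → ∑ℕ-zero {suc n} (λ d → refl)))
      (λ b → drop-zero-≤ {n} (∑ℕ-zero {suc n} (λ d → refl))
        (λ c → drop-zero-≤ {n} refl
          (λ d → forget (b <ᶠ d) (cliqueAdj s b c) (cliqueAdj s c d)))))
    (#paths-clique n s)
    where
    forget : ∀ x y z → [ x ∧ y ∧ z ∧ true ] ℕ.≤ [ x ∧ y ∧ z ]
    forget x y z = ℕ.≤-reflexive (cong (λ t → [ x ∧ y ∧ t ]) (∧-identityʳ z))
  a>0 : (∑ℕ {n} λ a → ∑ℕ {suc n} λ b → ∑ℕ {suc n} λ c → ∑ℕ {suc n} λ d →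
           [ suc a <ᶠ b ∧ suc a <ᶠ c ∧ b <ᶠ d ∧ adjacent (suc a) b ∧
             adjacent b c ∧ adjacent c d ∧ adjacent d (suc a) ])
         ℕ.≤ 3 ℕ.* (s C 4)
  a>0 = ℕ.≤-trans
    (∑ℕ-mono {n} (λ a → drop-zero-≤ {n} (∑ℕ-zero {suc n} (λ c → ∑ℕ-zero {suc n} (λ d → refl)))
      (λ b → drop-zero-≤ {n} (∑ℕ-zero {suc n} (λ d → cong [_] (∧-zeroʳ (a <ᶠ b))))
        (λ c → drop-zero-≤ {n} (no-cycle (a <ᶠ b) (a <ᶠ c)) (λ d → ℕ.≤-refl)))))
    (#C₄-clique n s)

-- Binomial coefficients as products

2*[n+1]C2 : ∀ n → 2 ℕ.* (suc n C 2) ≡ suc n ℕ.* n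
2*[n+1]C2 zero    = refl
2*[n+1]C2 (suc n) = begin
  2 ℕ.* (suc (suc n) C 2)
    ≡⟨ cong (2 ℕ.*_) (pascal (suc n) 1) ⟨
  2 ℕ.* (suc n C 1 ℕ.+ suc n C 2)
    ≡⟨ cong (λ x → 2 ℕ.* (x ℕ.+ suc n C 2)) (nC1≡n (suc n)) ⟩
  2 ℕ.* (suc n ℕ.+ suc n C 2)
    ≡⟨ ℕ.*-distribˡ-+ 2 (suc n) (suc n C 2) ⟩
  2 ℕ.* suc n ℕ.+ 2 ℕ.* (suc n C 2)
    ≡⟨ cong (2 ℕ.* suc n ℕ.+_) (2*[n+1]C2 n) ⟩
  2 ℕ.* suc n ℕ.+ suc n ℕ.* n
    ≡⟨ solve 1 (λ n → con 2 :* (con 1 :+ n) :+ (con 1 :+ n) :* n := (con 2 :+ n) :* (con 1 :+ n)) refl n ⟩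
  suc (suc n) ℕ.* suc n ∎
  where open ≡-Reasoning
        open ℕ.+-*-Solver

6*[n+2]C3 : ∀ n → 6 ℕ.* (suc (suc n) C 3) ≡ suc (suc n) ℕ.* suc n ℕ.* n
6*[n+2]C3 zero    = refl
6*[n+2]C3 (suc n) = begin
  6 ℕ.* (suc (suc (suc n)) C 3)
    ≡⟨ cong (6 ℕ.*_) (pascal (suc (suc n)) 2) ⟨
  6 ℕ.* (suc (suc n) C 2 ℕ.+ suc (suc n) C 3)
    ≡⟨ solve 2 (λ x y → con 6 :* (x :+ y) := con 3 :* (con 2 :* x) :+ con 6 :* y)
         refl (suc (suc n) C 2) (suc (suc n) C 3) ⟩
  3 ℕ.* (2 ℕ.* (suc (suc n) C 2)) ℕ.+ 6 ℕ.* (suc (suc n) C 3)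
    ≡⟨ cong₂ (λ x y → 3 ℕ.* x ℕ.+ y) (2*[n+1]C2 (suc n)) (6*[n+2]C3 n) ⟩
  3 ℕ.* (suc (suc n) ℕ.* suc n) ℕ.+ suc (suc n) ℕ.* suc n ℕ.* n
    ≡⟨ solve 1 (λ n → con 3 :* ((con 2 :+ n) :* (con 1 :+ n)) :+ (con 2 :+ n) :* (con 1 :+ n) :* n
                   := (con 3 :+ n) :* (con 2 :+ n) :* (con 1 :+ n)) refl n ⟩
  suc (suc (suc n)) ℕ.* suc (suc n) ℕ.* suc n ∎
  where open ≡-Reasoning
        open ℕ.+-*-Solver

24*[n+3]C4 : ∀ n → 24 ℕ.* (suc (suc (suc n)) C 4) ≡ suc (suc (suc n)) ℕ.* suc (suc n) ℕ.* suc n ℕ.* n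
24*[n+3]C4 zero    = refl
24*[n+3]C4 (suc n) = begin
  24 ℕ.* (4+n-choose 4)
    ≡⟨ cong (24 ℕ.*_) (pascal (suc (suc (suc n))) 3) ⟨
  24 ℕ.* (3+n-choose 3 ℕ.+ 3+n-choose 4)
    ≡⟨ solve 2 (λ x y → con 24 :* (x :+ y) := con 4 :* (con 6 :* x) :+ con 24 :* y)
         refl (3+n-choose 3) (3+n-choose 4) ⟩
  4 ℕ.* (6 ℕ.* 3+n-choose 3) ℕ.+ 24 ℕ.* 3+n-choose 4
    ≡⟨ cong₂ (λ x y → 4 ℕ.* x ℕ.+ y) (6*[n+2]C3 (suc n)) (24*[n+3]C4 n) ⟩
  4 ℕ.* (suc (suc (suc n)) ℕ.* suc (suc n) ℕ.* suc n) ℕ.+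
    suc (suc (suc n)) ℕ.* suc (suc n) ℕ.* suc n ℕ.* n
    ≡⟨ solve 1 (λ n →
         con 4 :* ((con 3 :+ n) :* (con 2 :+ n) :* (con 1 :+ n)) :+
           (con 3 :+ n) :* (con 2 :+ n) :* (con 1 :+ n) :* n :=
         (con 4 :+ n) :* (con 3 :+ n) :* (con 2 :+ n) :* (con 1 :+ n)) refl n ⟩
  suc (suc (suc (suc n))) ℕ.* suc (suc (suc n)) ℕ.* suc (suc n) ℕ.* suc n ∎
  where
  open ≡-Reasoning
  open ℕ.+-*-Solver
  4+n-choose 3+n-choose : ℕ → ℕ
  4+n-choose k = suc (suc (suc (suc n))) C k
  3+n-choose k = suc (suc (suc n)) C k

-- Eigenvectors of the pineapple graph

-- The eigenvector of the pineapple graph with s = u + 1 at eigenvalue x: the entries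
-- are proportional to 1 at the hub, 1/(x - u) on the rest of the clique and 1/x on
-- the leaves, and are scaled by x (x - u) to clear denominators.
pineappleWeight : ∀ {n} → ℕ → ℚ → Vector ℚ (suc n)
pineappleWeight u x zero    = x ℚ.* (x ℚ.- ι u)
pineappleWeight u x (suc i) = if toℕ i <ᵇ suc u then x else x ℚ.- ι u

-- x w - A w at the hub, for the weights w = pineappleWeight u x, with σ = u and κ = q.
-- At the other vertices A w = x w holds identically, so x is an eigenvalue when this
-- cubic vanishes.
hubExcess : (σ κ x : ℚ) → ℚ
hubExcess σ κ x = x ℚ.* (x ℚ.* (x ℚ.- σ)) ℚ.- ((1ℚ ℚ.+ σ) ℚ.* x ℚ.+ κ ℚ.* (x ℚ.- σ))

∑-zero : ∀ {n} {f : Vector ℚ n} → (∀ i → f i ≡ 0ℚ) → ∑ f ≡ 0ℚ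
∑-zero {zero}  f≡0 = refl
∑-zero {suc n} f≡0 = cong₂ ℚ._+_ (f≡0 zero) (∑-zero (λ i → f≡0 (suc i)))

∑-const : ∀ n c → ∑ {n} (λ _ → c) ≡ ι n ℚ.* c
∑-const zero    c = sym (trans (cong (ℚ._* c) ι-0) (ℚ.*-zeroˡ c))
∑-const (suc n) c = trans (cong (c ℚ.+_) (∑-const n c)) (ι-suc-* n c)
  where
  ι-suc-* : ∀ n c → c ℚ.+ ι n ℚ.* c ≡ ι (suc n) ℚ.* c
  ι-suc-* n c = trans
    (solve 2 (λ n c → c :+ n :* c := (con 1ℚ :+ n) :* c) refl (ι n) c)
    (cong (ℚ._* c) (sym (ι-suc n)))
    where open +-*-Solver

∑-split : ∀ s q a b →
  ∑ {s ℕ.+ q} (λ j → if toℕ j <ᵇ s then a else b) ≡ ι s ℚ.* a ℚ.+ ι q ℚ.* b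
∑-split zero q a b = trans (∑-const q b)
  (sym (trans (cong (λ z → z ℚ.* a ℚ.+ ι q ℚ.* b) ι-0)
    (trans (cong (ℚ._+ ι q ℚ.* b) (ℚ.*-zeroˡ a)) (ℚ.+-identityˡ (ι q ℚ.* b)))))
∑-split (suc s) q a b = trans (cong (a ℚ.+_) (∑-split s q a b))
  (trans (regroup a b (ι s) (ι q)) (cong (λ z → z ℚ.* a ℚ.+ ι q ℚ.* b) (sym (ι-suc s))))
  where
  regroup : ∀ a b s q → a ℚ.+ (s ℚ.* a ℚ.+ q ℚ.* b) ≡ (1ℚ ℚ.+ s) ℚ.* a ℚ.+ q ℚ.* b
  regroup = solve 4 (λ a b s q → a :+ (s :* a :+ q :* b) := (con 1ℚ :+ s) :* a :+ q :* b) refl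
    where open +-*-Solver

-- The row of a clique vertex, with a added for the missing diagonal term.
∑-clique-row : ∀ s q a b (i : Fin (s ℕ.+ q)) → (toℕ i <ᵇ s) ≡ true →
  a ℚ.+ ∑ (λ j → indicator (cliqueAdj s i j) ℚ.* (if toℕ j <ᵇ s then a else b)) ≡ ι s ℚ.* a
∑-clique-row (suc s) q a b zero _ = begin
  a ℚ.+ (0ℚ ℚ.* a ℚ.+ ∑ {s ℕ.+ q} (λ j → indicator ((toℕ j <ᵇ s) ∧ true) ℚ.* _))
    ≡⟨ cong₂ (λ x y → a ℚ.+ (x ℚ.+ y)) (ℚ.*-zeroˡ a)
         (trans (∑ℚ.sum-cong-≗ {s ℕ.+ q} (λ j → select (toℕ j <ᵇ s))) (∑-split s q a 0ℚ)) ⟩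
  a ℚ.+ (0ℚ ℚ.+ (ι s ℚ.* a ℚ.+ ι q ℚ.* 0ℚ))
    ≡⟨ regroup a (ι s) (ι q) ⟩
  (1ℚ ℚ.+ ι s) ℚ.* a
    ≡⟨ cong (ℚ._* a) (ι-suc s) ⟨
  ι (suc s) ℚ.* a ∎
  where
  open ≡-Reasoning
  select : ∀ t → indicator (t ∧ true) ℚ.* (if t then a else b) ≡ (if t then a else 0ℚ)
  select true  = ℚ.*-identityˡ a
  select false = ℚ.*-zeroˡ b
  regroup : ∀ a s q → a ℚ.+ (0ℚ ℚ.+ (s ℚ.* a ℚ.+ q ℚ.* 0ℚ)) ≡ (1ℚ ℚ.+ s) ℚ.* a
  regroup = solve 3 (λ a s q → a :+ (con 0ℚ :+ (s :* a :+ q :* con 0ℚ))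
                            := (con 1ℚ :+ s) :* a) refl
    where open +-*-Solver
∑-clique-row (suc s) q a b (suc i) i<s = begin
  a ℚ.+ (indicator ((toℕ i <ᵇ s) ∧ true) ℚ.* a ℚ.+ rest)
    ≡⟨ cong (λ t → a ℚ.+ (indicator (t ∧ true) ℚ.* a ℚ.+ rest)) i<s ⟩
  a ℚ.+ (1ℚ ℚ.* a ℚ.+ rest)
    ≡⟨ cong (λ t → a ℚ.+ (t ℚ.+ rest)) (ℚ.*-identityˡ a) ⟩
  a ℚ.+ (a ℚ.+ rest)
    ≡⟨ cong (a ℚ.+_) (∑-clique-row s q a b i i<s) ⟩
  a ℚ.+ ι s ℚ.* a
    ≡⟨ regroup a (ι s) ⟩
  (1ℚ ℚ.+ ι s) ℚ.* a
    ≡⟨ cong (ℚ._* a) (ι-suc s) ⟨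
  ι (suc s) ℚ.* a ∎
  where
  open ≡-Reasoning
  rest : ℚ
  rest = ∑ {s ℕ.+ q} (λ j → indicator (cliqueAdj s i j) ℚ.* (if toℕ j <ᵇ s then a else b))
  regroup : ∀ a s → a ℚ.+ s ℚ.* a ≡ (1ℚ ℚ.+ s) ℚ.* a
  regroup = solve 2 (λ a s → a :+ s :* a := (con 1ℚ :+ s) :* a) refl
    where open +-*-Solver

module _ (u q : ℕ) where

  private
    s : ℕ
    s = suc u
    G : Graph (suc (s ℕ.+ q))
    G = pineapple s q

  row-hub : ∀ x → ∑ (λ j → entry G zero j ℚ.* pineappleWeight u x j) ≡
    (1ℚ ℚ.+ ι u) ℚ.* x ℚ.+ ι q ℚ.* (x ℚ.- ι u)
  row-hub x = begin
    0ℚ ℚ.* w₀ ℚ.+ ∑ {s ℕ.+ q} (λ j → 1ℚ ℚ.* w j)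
      ≡⟨ cong₂ ℚ._+_ (ℚ.*-zeroˡ w₀) (∑ℚ.sum-cong-≗ {s ℕ.+ q} (λ j → ℚ.*-identityˡ (w j))) ⟩
    0ℚ ℚ.+ ∑ {s ℕ.+ q} w
      ≡⟨ ℚ.+-identityˡ _ ⟩
    ∑ {s ℕ.+ q} w
      ≡⟨ ∑-split s q x (x ℚ.- ι u) ⟩
    ι s ℚ.* x ℚ.+ ι q ℚ.* (x ℚ.- ι u)
      ≡⟨ cong (λ z → z ℚ.* x ℚ.+ ι q ℚ.* (x ℚ.- ι u)) (ι-suc u) ⟩
    (1ℚ ℚ.+ ι u) ℚ.* x ℚ.+ ι q ℚ.* (x ℚ.- ι u) ∎
    where
    open ≡-Reasoning
    w₀ : ℚ
    w₀ = x ℚ.* (x ℚ.- ι u)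
    w : Vector ℚ (s ℕ.+ q)
    w j = pineappleWeight u x (suc j)

  row-other : ∀ x (i : Fin (s ℕ.+ q)) →
    ∑ (λ j → entry G (suc i) j ℚ.* pineappleWeight u x j) ≡ x ℚ.* pineappleWeight u x (suc i)
  row-other x i = by-cases (toℕ i <ᵇ s) refl
    where
    open ≡-Reasoning
    w₀ rest : ℚ
    w₀ = x ℚ.* (x ℚ.- ι u)
    rest = ∑ (λ j → indicator (cliqueAdj s i j) ℚ.* (if toℕ j <ᵇ s then x else x ℚ.- ι u))
    by-cases : ∀ t → (toℕ i <ᵇ s) ≡ t →
      1ℚ ℚ.* w₀ ℚ.+ rest ≡ x ℚ.* (if toℕ i <ᵇ s then x else x ℚ.- ι u)
    by-cases true i<s = begin
      1ℚ ℚ.* w₀ ℚ.+ rest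
        ≡⟨ regroup x (ι u) rest ⟩
      (x ℚ.* (x ℚ.- ι u) ℚ.- x) ℚ.+ (x ℚ.+ rest)
        ≡⟨ cong ((x ℚ.* (x ℚ.- ι u) ℚ.- x) ℚ.+_)
             (trans (∑-clique-row s q x (x ℚ.- ι u) i i<s) (cong (ℚ._* x) (ι-suc u))) ⟩
      (x ℚ.* (x ℚ.- ι u) ℚ.- x) ℚ.+ (1ℚ ℚ.+ ι u) ℚ.* x
        ≡⟨ simplify x (ι u) ⟩
      x ℚ.* x
        ≡⟨ cong (λ t → x ℚ.* (if t then x else x ℚ.- ι u)) i<s ⟨
      x ℚ.* (if toℕ i <ᵇ s then x else x ℚ.- ι u) ∎
      where
      open +-*-Solver
      regroup : ∀ x σ r → 1ℚ ℚ.* (x ℚ.* (x ℚ.- σ)) ℚ.+ r ≡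
                          (x ℚ.* (x ℚ.- σ) ℚ.- x) ℚ.+ (x ℚ.+ r)
      regroup = solve 3 (λ x σ r → con 1ℚ :* (x :* (x :+ :- σ)) :+ r :=
                                   (x :* (x :+ :- σ) :+ :- x) :+ (x :+ r)) refl
      simplify : ∀ x σ → (x ℚ.* (x ℚ.- σ) ℚ.- x) ℚ.+ (1ℚ ℚ.+ σ) ℚ.* x ≡ x ℚ.* x
      simplify = solve 2 (λ x σ → (x :* (x :+ :- σ) :+ :- x) :+ (con 1ℚ :+ σ) :* x := x :* x) refl
    by-cases false i≮s = begin
      1ℚ ℚ.* w₀ ℚ.+ rest
        ≡⟨ cong₂ ℚ._+_ (ℚ.*-identityˡ w₀) (∑-zero {s ℕ.+ q} (λ j → vanish j)) ⟩
      w₀ ℚ.+ 0ℚ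
        ≡⟨ ℚ.+-identityʳ w₀ ⟩
      x ℚ.* (x ℚ.- ι u)
        ≡⟨ cong (λ t → x ℚ.* (if t then x else x ℚ.- ι u)) i≮s ⟨
      x ℚ.* (if toℕ i <ᵇ s then x else x ℚ.- ι u) ∎
      where
      vanish : ∀ j → indicator (cliqueAdj s i j) ℚ.* (if toℕ j <ᵇ s then x else x ℚ.- ι u) ≡ 0ℚ
      vanish j = trans
        (cong (λ t → indicator (t ∧ (toℕ j <ᵇ s) ∧ not (toℕ i ≡ᵇ toℕ j)) ℚ.*
                     (if toℕ j <ᵇ s then x else x ℚ.- ι u)) i≮s)
        (ℚ.*-zeroˡ (if toℕ j <ᵇ s then x else x ℚ.- ι u))

-- The hub polynomial

-- The hub polynomial p changes sign between a and N = σ + 2.  Here M stands for the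
-- number of edges, as the hypothesis size records.  The point a = N - t is Newton's
-- iterate from N towards √M, so that a² = M + t² lies just above M.  In terms of M,
--   p(x) = (x - σ)(x² - M) - ½ σ (σ + 1) (N - x),
-- whence p(a) = t ((2 - t) t - ½ σ (σ + 1)) and p(N) = 2 (N² - M) = 4 N t.
module HubPolynomial
  (σ κ M t : ℚ) (1≤σ : 1ℚ ℚ.≤ σ) (0≤κ : 0ℚ ℚ.≤ κ) (0<t : 0ℚ ℚ.< t) (t≤1 : t ℚ.≤ 1ℚ)
  (newton : M ℚ.+ ((1ℚ ℚ.+ (1ℚ ℚ.+ σ)) ℚ.* t ℚ.+ (1ℚ ℚ.+ (1ℚ ℚ.+ σ)) ℚ.* t) ≡
            (1ℚ ℚ.+ (1ℚ ℚ.+ σ)) ℚ.* (1ℚ ℚ.+ (1ℚ ℚ.+ σ)))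
  (size : M ℚ.+ M ≡ (1ℚ ℚ.+ (1ℚ ℚ.+ σ)) ℚ.* (1ℚ ℚ.+ σ) ℚ.+ (κ ℚ.+ κ))
  where

  open +-*-Solver

  N : ℚ
  N = 1ℚ ℚ.+ (1ℚ ℚ.+ σ)

  p : ℚ → ℚ
  p = hubExcess σ κ

  a : ℚ
  a = N ℚ.- t

  0≤t : 0ℚ ℚ.≤ t
  0≤t = ℚ.<⇒≤ 0<t
  0≤σ : 0ℚ ℚ.≤ σ
  0≤σ = ℚ.≤-trans 0≤1 1≤σ
  0≤N : 0ℚ ℚ.≤ N
  0≤N = 0≤+ 0≤1 (0≤+ 0≤1 0≤σ)

  M≡ : M ≡ N ℚ.* N ℚ.- (N ℚ.* t ℚ.+ N ℚ.* t)
  M≡ = trans (solve 2 (λ M b → M := (M :+ b) :+ :- b) refl M (N ℚ.* t ℚ.+ N ℚ.* t))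
             (cong (ℚ._- (N ℚ.* t ℚ.+ N ℚ.* t)) newton)

  κ≡ : κ ≡ (N ℚ.* N ℚ.- (N ℚ.* t ℚ.+ N ℚ.* t)) ℚ.- ½ ℚ.* (N ℚ.* (1ℚ ℚ.+ σ))
  κ≡ = begin
    κ
      ≡⟨ solve 2 (λ κ b → κ := con ½ :* (b :+ (κ :+ κ)) :+ :- (con ½ :* b)) refl κ (N ℚ.* (1ℚ ℚ.+ σ)) ⟩
    ½ ℚ.* (N ℚ.* (1ℚ ℚ.+ σ) ℚ.+ (κ ℚ.+ κ)) ℚ.- ½ ℚ.* (N ℚ.* (1ℚ ℚ.+ σ))
      ≡⟨ cong (λ z → ½ ℚ.* z ℚ.- ½ ℚ.* (N ℚ.* (1ℚ ℚ.+ σ))) size ⟨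
    ½ ℚ.* (M ℚ.+ M) ℚ.- ½ ℚ.* (N ℚ.* (1ℚ ℚ.+ σ))
      ≡⟨ cong (ℚ._- ½ ℚ.* (N ℚ.* (1ℚ ℚ.+ σ)))
           (solve 1 (λ M → con ½ :* (M :+ M) := M) refl M) ⟩
    M ℚ.- ½ ℚ.* (N ℚ.* (1ℚ ℚ.+ σ))
      ≡⟨ cong (ℚ._- ½ ℚ.* (N ℚ.* (1ℚ ℚ.+ σ))) M≡ ⟩
    (N ℚ.* N ℚ.- (N ℚ.* t ℚ.+ N ℚ.* t)) ℚ.- ½ ℚ.* (N ℚ.* (1ℚ ℚ.+ σ)) ∎
    where open ≡-Reasoning

  -- (2 - t) t ≤ 1 ≤ ½ σ (σ + 1), where 1 - (2 - t) t = (1 - t)² and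
  -- ½ σ (σ + 1) - 1 = ½ (σ - 1) N.
  p-a≤0 : p a ℚ.≤ 0ℚ
  p-a≤0 = ≤-by
    (t ℚ.* (½ ℚ.* ((σ ℚ.- 1ℚ) ℚ.* N) ℚ.+ (1ℚ ℚ.- t) ℚ.* (1ℚ ℚ.- t)))
    (0≤* 0≤t (0≤+ (0≤* 0≤½ (0≤* (0≤- 1≤σ) 0≤N)) (0≤* (0≤- t≤1) (0≤- t≤1))))
    (trans (cong (λ k → hubExcess σ k a ℚ.+
                        t ℚ.* (½ ℚ.* ((σ ℚ.- 1ℚ) ℚ.* N) ℚ.+ (1ℚ ℚ.- t) ℚ.* (1ℚ ℚ.- t))) κ≡)
           (identity σ t))
    where
    identity : ∀ σ t → let N = 1ℚ ℚ.+ (1ℚ ℚ.+ σ) in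
      hubExcess σ ((N ℚ.* N ℚ.- (N ℚ.* t ℚ.+ N ℚ.* t)) ℚ.- ½ ℚ.* (N ℚ.* (1ℚ ℚ.+ σ))) (N ℚ.- t) ℚ.+
      t ℚ.* (½ ℚ.* ((σ ℚ.- 1ℚ) ℚ.* N) ℚ.+ (1ℚ ℚ.- t) ℚ.* (1ℚ ℚ.- t)) ≡ 0ℚ
    identity = solve 2 (λ σ t →
      let N = con 1ℚ :+ (con 1ℚ :+ σ)
          k = (N :* N :+ :- (N :* t :+ N :* t)) :+ :- (con ½ :* (N :* (con 1ℚ :+ σ)))
          x = N :+ :- t
      in (x :* (x :* (x :+ :- σ)) :+ :- ((con 1ℚ :+ σ) :* x :+ k :* (x :+ :- σ))) :+
         t :* (con ½ :* ((σ :+ :- con 1ℚ) :* N) :+ (con 1ℚ :+ :- t) :* (con 1ℚ :+ :- t)) := con 0ℚ)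
      refl

  0≤p-N : 0ℚ ℚ.≤ p (a ℚ.+ t)
  0≤p-N = ≤-by ((1ℚ ℚ.+ 1ℚ) ℚ.* (N ℚ.* t ℚ.+ N ℚ.* t))
    (0≤* (0≤+ 0≤1 0≤1) (0≤+ (0≤* 0≤N 0≤t) (0≤* 0≤N 0≤t)))
    (trans (identity σ t) (cong (λ k → hubExcess σ k (a ℚ.+ t)) (sym κ≡)))
    where
    identity : ∀ σ t → let N = 1ℚ ℚ.+ (1ℚ ℚ.+ σ) in
      0ℚ ℚ.+ (1ℚ ℚ.+ 1ℚ) ℚ.* (N ℚ.* t ℚ.+ N ℚ.* t) ≡
      hubExcess σ ((N ℚ.* N ℚ.- (N ℚ.* t ℚ.+ N ℚ.* t)) ℚ.- ½ ℚ.* (N ℚ.* (1ℚ ℚ.+ σ)))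
        ((N ℚ.- t) ℚ.+ t)
    identity = solve 2 (λ σ t →
      let N = con 1ℚ :+ (con 1ℚ :+ σ)
          k = (N :* N :+ :- (N :* t :+ N :* t)) :+ :- (con ½ :* (N :* (con 1ℚ :+ σ)))
          x = (N :+ :- t) :+ t
      in con 0ℚ :+ (con 1ℚ :+ con 1ℚ) :* (N :* t :+ N :* t) :=
         (x :* (x :* (x :+ :- σ)) :+ :- ((con 1ℚ :+ σ) :* x :+ k :* (x :+ :- σ))))
      refl

  1+σ≤a : 1ℚ ℚ.+ σ ℚ.≤ a
  1+σ≤a = ≤-by (1ℚ ℚ.- t) (0≤- t≤1)
    (solve 2 (λ σ t → (con 1ℚ :+ σ) :+ (con 1ℚ :+ :- t) := (con 1ℚ :+ (con 1ℚ :+ σ)) :+ :- t) refl σ t)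

  1≤a : 1ℚ ℚ.≤ a
  1≤a = ℚ.≤-trans (≤-by σ 0≤σ refl) 1+σ≤a

  0<x : ∀ {x} → a ℚ.≤ x → 0ℚ ℚ.< x
  0<x a≤x = ℚ.<-≤-trans (ℚ.positive⁻¹ 1ℚ) (ℚ.≤-trans 1≤a a≤x)

  0<x-σ : ∀ {x} → a ℚ.≤ x → 0ℚ ℚ.< x ℚ.- σ
  0<x-σ {x} a≤x = 0<- (ℚ.<-≤-trans
    (subst (ℚ._< 1ℚ ℚ.+ σ) (ℚ.+-identityˡ σ) (ℚ.+-monoˡ-< σ (ℚ.positive⁻¹ 1ℚ)))
    (ℚ.≤-trans 1+σ≤a a≤x))

  slope : ℚ
  slope = N ℚ.* N ℚ.+ (N ℚ.* N ℚ.+ N ℚ.* N)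

  -- The slope of p on [0 , N] is at most slope = 3N²: the divided difference is
  -- x² + xy + y² - σ (x + y) - (1 + σ + κ) with y = x + h.
  p-lipschitz : ∀ {x h} → 0ℚ ℚ.≤ x → 0ℚ ℚ.≤ h → x ℚ.+ h ℚ.≤ N →
    p (x ℚ.+ h) ℚ.- p x ℚ.≤ slope ℚ.* h
  p-lipschitz {x} {h} 0≤x 0≤h x+h≤N = ≤-by
    (h ℚ.* (((N ℚ.* d ℚ.+ x ℚ.* d) ℚ.+ ((N ℚ.* d ℚ.+ x ℚ.* e) ℚ.+ (N ℚ.* e ℚ.+ y ℚ.* e))) ℚ.+
            (σ ℚ.* (x ℚ.+ y) ℚ.+ (1ℚ ℚ.+ (σ ℚ.+ κ)))))
    (0≤* 0≤h (0≤+
      (0≤+ (0≤+ (0≤* 0≤N 0≤d) (0≤* 0≤x 0≤d))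
        (0≤+ (0≤+ (0≤* 0≤N 0≤d) (0≤* 0≤x 0≤e)) (0≤+ (0≤* 0≤N 0≤e) (0≤* 0≤y 0≤e))))
      (0≤+ (0≤* 0≤σ (0≤+ 0≤x 0≤y)) (0≤+ 0≤1 (0≤+ 0≤σ 0≤κ)))))
    (identity σ κ N x h)
    where
    y d e : ℚ
    y = x ℚ.+ h
    d = N ℚ.- x
    e = N ℚ.- y
    0≤y : 0ℚ ℚ.≤ y
    0≤y = 0≤+ 0≤x 0≤h
    0≤e : 0ℚ ℚ.≤ e
    0≤e = 0≤- x+h≤N
    0≤d : 0ℚ ℚ.≤ d
    0≤d = 0≤- (ℚ.≤-trans (≤-by h 0≤h refl) x+h≤N)
    identity : ∀ σ κ N x h → let y = x ℚ.+ h; d = N ℚ.- x; e = N ℚ.- y in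
      (hubExcess σ κ y ℚ.- hubExcess σ κ x) ℚ.+
      (h ℚ.* (((N ℚ.* d ℚ.+ x ℚ.* d) ℚ.+ ((N ℚ.* d ℚ.+ x ℚ.* e) ℚ.+ (N ℚ.* e ℚ.+ y ℚ.* e))) ℚ.+
              (σ ℚ.* (x ℚ.+ y) ℚ.+ (1ℚ ℚ.+ (σ ℚ.+ κ))))) ≡
      (N ℚ.* N ℚ.+ (N ℚ.* N ℚ.+ N ℚ.* N)) ℚ.* h
    identity = solve 5 (λ σ κ N x h →
      let y = x :+ h
          d = N :+ :- x
          e = N :+ :- y
          P = λ x → x :* (x :* (x :+ :- σ)) :+ :- ((con 1ℚ :+ σ) :* x :+ κ :* (x :+ :- σ))
      in (P y :+ :- P x) :+
         (h :* (((N :* d :+ x :* d) :+ ((N :* d :+ x :* e) :+ (N :* e :+ y :* e))) :+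
                (σ :* (x :+ y) :+ (con 1ℚ :+ (σ :+ κ))))) :=
         (N :* N :+ (N :* N :+ N :* N)) :* h) refl

  -- As a² = M + t², the gap g = t² / 2a separates √M from a: (a - g)² = M + g².
  √M<a : ∃[ g ] (0ℚ ℚ.< g × (∀ r → r ℚ.* r ℚ.≤ M → r ℚ.+ g ℚ.≤ a))
  √M<a = from (divide (ℚ.+-mono-< (0<x ℚ.≤-refl) (0<x ℚ.≤-refl)) (0<* 0<t 0<t))
    where
    from : ∃[ g ] (0ℚ ℚ.< g × (a ℚ.+ a) ℚ.* g ≡ t ℚ.* t) →
           ∃[ g ] (0ℚ ℚ.< g × (∀ r → r ℚ.* r ℚ.≤ M → r ℚ.+ g ℚ.≤ a))
    from (g , 0<g , 2ag≡t²) = g , 0<g , λ r r²≤M →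
      subst (r ℚ.+ g ℚ.≤_) (solve 2 (λ a g → (a :+ :- g) :+ g := a) refl a g)
        (ℚ.+-monoˡ-≤ g (sq-cancel-≤ {r} (0≤- g≤a) (ℚ.≤-trans r²≤M M≤)))
      where
      t≤a : t ℚ.≤ a
      t≤a = ℚ.≤-trans t≤1 1≤a
      0<a : 0ℚ ℚ.< a
      0<a = 0<x ℚ.≤-refl
      0≤a : 0ℚ ℚ.≤ a
      0≤a = ℚ.<⇒≤ 0<a
      g≤a : g ℚ.≤ a
      g≤a = *-cancelˡ-0< (a ℚ.+ a) (ℚ.+-mono-< 0<a 0<a)
        (subst (ℚ._≤ (a ℚ.+ a) ℚ.* a) (sym 2ag≡t²)
          (≤-by (a ℚ.* a ℚ.+ (t ℚ.* (a ℚ.- t) ℚ.+ a ℚ.* (a ℚ.- t)))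
            (0≤+ (0≤* 0≤a 0≤a) (0≤+ (0≤* 0≤t (0≤- t≤a)) (0≤* 0≤a (0≤- t≤a))))
            (solve 2 (λ t a → t :* t :+ (a :* a :+ (t :* (a :+ :- t) :+ a :* (a :+ :- t)))
                            := (a :+ a) :* a) refl t a)))
      M≤ : M ℚ.≤ (a ℚ.- g) ℚ.* (a ℚ.- g)
      M≤ = ≤-by (g ℚ.* g) (0≤* (ℚ.<⇒≤ 0<g) (ℚ.<⇒≤ 0<g)) (begin
        M ℚ.+ g ℚ.* g
          ≡⟨ cong (ℚ._+ g ℚ.* g) M≡ ⟩
        (N ℚ.* N ℚ.- (N ℚ.* t ℚ.+ N ℚ.* t)) ℚ.+ g ℚ.* g
          ≡⟨ solve 3 (λ N t g → (N :* N :+ :- (N :* t :+ N :* t)) :+ g :* g :=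
               ((N :+ :- t) :* (N :+ :- t) :+ :- (t :* t)) :+ g :* g) refl N t g ⟩
        (a ℚ.* a ℚ.- t ℚ.* t) ℚ.+ g ℚ.* g
          ≡⟨ cong (λ z → (a ℚ.* a ℚ.- z) ℚ.+ g ℚ.* g) 2ag≡t² ⟨
        (a ℚ.* a ℚ.- (a ℚ.+ a) ℚ.* g) ℚ.+ g ℚ.* g
          ≡⟨ solve 2 (λ a g → (a :* a :+ :- ((a :+ a) :* g)) :+ g :* g :=
               (a :+ :- g) :* (a :+ :- g)) refl a g ⟩
        (a ℚ.- g) ℚ.* (a ℚ.- g) ∎)
        where open ≡-Reasoning

-- The spectral radius of the pineapple graph

-- The spectral radius of the pineapple graph with s = u + 1, as the limit of bisection
-- of the hub polynomial on [N - t , N].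
module PineappleSpectrum
  (u q : ℕ) (M t : ℚ) (1≤u : 1ℚ ℚ.≤ ι u) (0<t : 0ℚ ℚ.< t) (t≤1 : t ℚ.≤ 1ℚ)
  (newton : M ℚ.+ ((1ℚ ℚ.+ (1ℚ ℚ.+ ι u)) ℚ.* t ℚ.+ (1ℚ ℚ.+ (1ℚ ℚ.+ ι u)) ℚ.* t) ≡ (1ℚ ℚ.+ (1ℚ ℚ.+ ι u)) ℚ.* (1ℚ ℚ.+ (1ℚ ℚ.+ ι u)))
  (size : M ℚ.+ M ≡ (1ℚ ℚ.+ (1ℚ ℚ.+ ι u)) ℚ.* (1ℚ ℚ.+ ι u) ℚ.+ (ι q ℚ.+ ι q))
  where

  open HubPolynomial (ι u) (ι q) M t 1≤u (0≤ι q) 0<t t≤1 newton size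
  open Bisection p a t 0<t p-a≤0 0≤p-N public

  G : Graph (suc (suc u ℕ.+ q))
  G = pineapple (suc u) q

  eigenvector : Vector ℝ (suc (suc u ℕ.+ q))
  eigenvector zero    = root * (root - fromℚ (ι u))
  eigenvector (suc i) = if toℕ i <ᵇ suc u then root else root - fromℚ (ι u)

  seq-eigenvector : ∀ k i → seq (eigenvector i) k ≡ pineappleWeight u (lo k) i
  seq-eigenvector k zero    = refl
  seq-eigenvector k (suc i) = by-cases (toℕ i <ᵇ suc u)
    where
    by-cases : ∀ b → seq (if b then root else root - fromℚ (ι u)) k ≡
                     (if b then lo k else lo k ℚ.- ι u)
    by-cases true  = refl
    by-cases false = refl

  row-eigenvector : ∀ k i → seq ((adjacencyMatrix G *ᵥ eigenvector) i) k ≡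
    ∑ (λ j → entry G i j ℚ.* pineappleWeight u (lo k) j)
  row-eigenvector k i = trans (seq-row G eigenvector i k)
    (∑ℚ.sum-cong-≗ (λ j → cong (entry G i j ℚ.*_) (seq-eigenvector k j)))

  -- p (lo k) ≤ 0 ≤ p (hi k), so p (lo k) is bounded by the variation of p.
  -p-lo≤ : ∀ k → ℚ.- p (lo k) ℚ.≤ slope ℚ.* width k
  -p-lo≤ k = ℚ.≤-trans
    (≤-by (p (hi k)) (f-hi k) (ℚ.+-comm (ℚ.- p (lo k)) (p (hi k))))
    (p-lipschitz (ℚ.<⇒≤ (0<x (a≤lo k))) (ℚ.<⇒≤ (0<width k))
      (subst (hi k ℚ.≤_) (cancel N t) (hi≤a+d k)))
    where
    cancel : ∀ N t → (N ℚ.- t) ℚ.+ t ≡ N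
    cancel = solve 2 (λ N t → (N :+ :- t) :+ t := N) refl
      where open +-*-Solver

  0≤slope : 0ℚ ℚ.≤ slope
  0≤slope = 0≤+ 0≤N² (0≤+ 0≤N² 0≤N²)
    where
    0≤N² : 0ℚ ℚ.≤ N ℚ.* N
    0≤N² = 0≤* 0≤N 0≤N

  -- Only the hub row needs a limit; the other rows hold exactly at every index.
  root-isEigenvalue : IsEigenvalue (adjacencyMatrix G) root
  root-isEigenvalue = eigenvector , (suc zero , inj₂ (mk< a (0<x ℚ.≤-refl) (0 , above))) , rows
    where
    above : ∀ k → 0 ℕ.≤ k → seq 0ℝ k ℚ.+ a ℚ.≤ lo k
    above k _ = subst (ℚ._≤ lo k) (sym (ℚ.+-identityˡ a)) (a≤lo k)

    rows : ∀ i → (adjacencyMatrix G *ᵥ eigenvector) i ≈ root * eigenvector i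
    rows zero = mk≈ λ ε 0<ε → from (divide 0<1+slope 0<ε)
      where
      0<1+slope : 0ℚ ℚ.< 1ℚ ℚ.+ slope
      0<1+slope = 0<1+ 0≤slope
      difference : ∀ k → seq ((adjacencyMatrix G *ᵥ eigenvector) zero) k ℚ.-
                         seq (root * eigenvector zero) k ≡ ℚ.- p (lo k)
      difference k = trans
        (cong (ℚ._- seq (root * eigenvector zero) k)
          (trans (row-eigenvector k zero) (row-hub u q (lo k))))
        (flip (lo k ℚ.* (lo k ℚ.* (lo k ℚ.- ι u)))
          ((1ℚ ℚ.+ ι u) ℚ.* lo k ℚ.+ ι q ℚ.* (lo k ℚ.- ι u)))
        where
        flip : ∀ A B → B ℚ.- A ≡ ℚ.- (A ℚ.- B)
        flip = solve 2 (λ A B → B :+ :- A := :- (A :+ :- B)) refl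
          where open +-*-Solver
      bound : ∀ {k δ} → width k ℚ.≤ δ →
        ℚ.∣ seq ((adjacencyMatrix G *ᵥ eigenvector) zero) k ℚ.-
            seq (root * eigenvector zero) k ∣ ℚ.≤ (1ℚ ℚ.+ slope) ℚ.* δ
      bound {k} {δ} w≤δ = begin
        ℚ.∣ seq ((adjacencyMatrix G *ᵥ eigenvector) zero) k ℚ.- seq (root * eigenvector zero) k ∣
          ≡⟨ cong ℚ.∣_∣ (difference k) ⟩
        ℚ.∣ ℚ.- p (lo k) ∣
          ≡⟨ ℚ.0≤p⇒∣p∣≡p (ℚ.neg-antimono-≤ (f-lo k)) ⟩
        ℚ.- p (lo k)
          ≤⟨ -p-lo≤ k ⟩
        slope ℚ.* width k
          ≤⟨ ≤-by (width k) (ℚ.<⇒≤ (0<width k)) (one-more slope (width k)) ⟩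
        (1ℚ ℚ.+ slope) ℚ.* width k
          ≤⟨ *-monoˡ-0≤ (1ℚ ℚ.+ slope) (ℚ.<⇒≤ 0<1+slope) w≤δ ⟩
        (1ℚ ℚ.+ slope) ℚ.* δ ∎
        where
        open ℚ.≤-Reasoning
        one-more : ∀ c w → c ℚ.* w ℚ.+ w ≡ (1ℚ ℚ.+ c) ℚ.* w
        one-more = solve 2 (λ c w → c :* w :+ w := (con 1ℚ :+ c) :* w) refl
          where open +-*-Solver
      from : ∀ {ε} → ∃[ δ ] (0ℚ ℚ.< δ × (1ℚ ℚ.+ slope) ℚ.* δ ≡ ε) →
        ∃[ K ] (∀ k → K ℕ.≤ k →
          ℚ.∣ seq ((adjacencyMatrix G *ᵥ eigenvector) zero) k ℚ.-
              seq (root * eigenvector zero) k ∣ ℚ.≤ ε)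
      from (δ , 0<δ , slope*δ≡ε) =
        proj₁ (width→0 δ 0<δ) , λ k K≤k →
          subst (_ ℚ.≤_) slope*δ≡ε (bound {k} (proj₂ (width→0 δ 0<δ) k K≤k))
    rows (suc i) = mk≈ λ ε 0<ε → 0 , λ k _ →
      subst (ℚ._≤ ε) (sym (cong ℚ.∣_∣ (difference k))) (ℚ.<⇒≤ 0<ε)
      where
      difference : ∀ k → seq ((adjacencyMatrix G *ᵥ eigenvector) (suc i)) k ℚ.-
                         seq (root * eigenvector (suc i)) k ≡ 0ℚ
      difference k = trans
        (cong₂ ℚ._-_ (trans (row-eigenvector k (suc i)) (row-other u q (lo k) i))
                     (cong (lo k ℚ.*_) (seq-eigenvector k (suc i))))
        (ℚ.+-inverseʳ (lo k ℚ.* pineappleWeight u (lo k) (suc i)))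

  ∣root∣≈root : ∣ root ∣ ≈ root
  ∣root∣≈root = mk≈ λ ε 0<ε → 0 , λ k _ →
    subst (ℚ._≤ ε) (sym (cong ℚ.∣_∣ (difference k))) (ℚ.<⇒≤ 0<ε)
    where
    difference : ∀ k → ℚ.∣ lo k ∣ ℚ.- lo k ≡ 0ℚ
    difference k = trans (cong (ℚ._- lo k) (ℚ.0≤p⇒∣p∣≡p (ℚ.<⇒≤ (0<x (a≤lo k)))))
                         (ℚ.+-inverseʳ (lo k))

  a≤hi : ∀ k → a ℚ.≤ hi k
  a≤hi k = ℚ.≤-trans (a≤lo k) (lo≤hi k)

  0<weight : ∀ k (i : Fin (suc (suc u ℕ.+ q))) → 0ℚ ℚ.< pineappleWeight u (hi k) i
  0<weight k zero    = 0<* (0<x (a≤hi k)) (0<x-σ (a≤hi k))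
  0<weight k (suc i) = by-cases (toℕ i <ᵇ suc u)
    where
    by-cases : ∀ b → 0ℚ ℚ.< (if b then hi k else hi k ℚ.- ι u)
    by-cases true  = 0<x (a≤hi k)
    by-cases false = 0<x-σ (a≤hi k)

  -- At an upper end point the hub excess is nonnegative, which makes the weights there
  -- a certificate for the Collatz–Wielandt bound.
  Aw≤hi*w : ∀ k i → ∑ (λ j → entry G i j ℚ.* pineappleWeight u (hi k) j) ℚ.≤
                    hi k ℚ.* pineappleWeight u (hi k) i
  Aw≤hi*w k zero    = ≤-by (p (hi k)) (f-hi k)
    (trans (cong (ℚ._+ p (hi k)) (row-hub u q (hi k)))
           (cancel (hi k ℚ.* (hi k ℚ.* (hi k ℚ.- ι u)))
             ((1ℚ ℚ.+ ι u) ℚ.* hi k ℚ.+ ι q ℚ.* (hi k ℚ.- ι u))))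
    where
    cancel : ∀ A B → B ℚ.+ (A ℚ.- B) ≡ A
    cancel = solve 2 (λ A B → B :+ (A :+ :- B) := A) refl
      where open +-*-Solver
  Aw≤hi*w k (suc i) = ℚ.≤-reflexive (row-other u q (hi k) i)

  root-isRadius : IsSpectralRadius G root
  root-isRadius = (root , root-isEigenvalue , ∣root∣≈root) , λ μ isEigenvalue →
    ≤root ∣ μ ∣ (λ k →
      ∣eigenvalue∣≤ G (pineappleWeight u (hi k)) (hi k) (0<weight k) (Aw≤hi*w k) μ isEigenvalue)

  <root : ∀ y → (∀ k → seq y k ℚ.* seq y k ℚ.≤ M) → y < root
  <root y y²≤M = from √M<a
    where
    from : ∃[ g ] (0ℚ ℚ.< g × (∀ r → r ℚ.* r ℚ.≤ M → r ℚ.+ g ℚ.≤ a)) → y < root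
    from (g , 0<g , r+g≤a) = mk< g 0<g (0 , λ k _ →
      ℚ.≤-trans (r+g≤a (seq y k) (y²≤M k)) (a≤lo k))

-- The bound on f

√-seq² : ∀ m k → √-seq m k ℚ.* √-seq m k ℚ.≤ ι m
√-seq² m k = *-cancelˡ-0< (d ℚ.* d) (0<* (0<ι-suc k) (0<ι-suc k)) (begin
  (d ℚ.* d) ℚ.* (r ℚ.* r)       ≡⟨ interchange d r ⟩
  (r ℚ.* d) ℚ.* (r ℚ.* d)       ≡⟨ cong₂ ℚ._*_ (/-*-cancel x k) (/-*-cancel x k) ⟩
  ι x ℚ.* ι x                   ≡⟨ ι-* x x ⟨
  ι (x ℕ.* x)                   ≤⟨ ι-mono-≤ (isqrt-lower (m ℕ.* (suc k ℕ.* suc k))) ⟩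
  ι (m ℕ.* (suc k ℕ.* suc k))   ≡⟨ ι-* m (suc k ℕ.* suc k) ⟩
  ι m ℚ.* ι (suc k ℕ.* suc k)   ≡⟨ cong (ι m ℚ.*_) (ι-* (suc k) (suc k)) ⟩
  ι m ℚ.* (d ℚ.* d)             ≡⟨ ℚ.*-comm (ι m) (d ℚ.* d) ⟩
  (d ℚ.* d) ℚ.* ι m             ∎)
  where
  open ℚ.≤-Reasoning
  d r : ℚ
  d = ι (suc k)
  r = √-seq m k
  x : ℕ
  x = isqrt (m ℕ.* (suc k ℕ.* suc k))
  interchange : ∀ d r → (d ℚ.* d) ℚ.* (r ℚ.* r) ≡ (r ℚ.* d) ℚ.* (r ℚ.* d)
  interchange = solve 2 (λ d r → (d :* d) :* (r :* r) := (r :* d) :* (r :* d)) refl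
    where open +-*-Solver

eighth : ℚ
eighth = + 1 ℚ./ 8

-- (M - 1)(M - 2√M) is increasing in M.  Here S² ≤ M, and r
-- approximates √M from below; the key inequality is 2r ≤ 2√M ≤ E, where E = (M - S²) + 2S and
-- E² - 4M = (M - S²)² + 4 (M - S²)(S - 1).
bound-mono : ∀ {S M r V} → 1ℚ ℚ.+ 1ℚ ℚ.≤ S → S ℚ.* S ℚ.≤ M → r ℚ.* r ℚ.≤ M →
  V ℚ.≤ (S ℚ.* S ℚ.- 1ℚ) ℚ.* (S ℚ.* S ℚ.- (1ℚ ℚ.+ 1ℚ) ℚ.* S) ℚ.* eighth →
  V ℚ.≤ (M ℚ.- 1ℚ) ℚ.* (M ℚ.- (1ℚ ℚ.+ 1ℚ) ℚ.* r) ℚ.* eighth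
bound-mono {S} {M} {r} 2≤S S²≤M r²≤M V≤ = ℚ.≤-trans V≤
  (ℚ.*-monoʳ-≤-nonNeg eighth (≤-by
    {(S ℚ.* S ℚ.- 1ℚ) ℚ.* (S ℚ.* S ℚ.- (1ℚ ℚ.+ 1ℚ) ℚ.* S)}
    ((M ℚ.- 1ℚ) ℚ.* (E ℚ.- (1ℚ ℚ.+ 1ℚ) ℚ.* r) ℚ.+ T ℚ.* (S ℚ.* (S ℚ.- (1ℚ ℚ.+ 1ℚ))))
    (0≤+ (0≤* (0≤- 1≤M) (0≤- 2r≤E)) (0≤* 0≤T (0≤* 0≤S (0≤- 2≤S))))
    (identity S M r)))
  where
  open +-*-Solver
  T E : ℚ
  T = M ℚ.- S ℚ.* S
  E = T ℚ.+ (1ℚ ℚ.+ 1ℚ) ℚ.* S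
  0≤2 : 0ℚ ℚ.≤ 1ℚ ℚ.+ 1ℚ
  0≤2 = 0≤+ 0≤1 0≤1
  1≤S : 1ℚ ℚ.≤ S
  1≤S = ℚ.≤-trans (≤-by 1ℚ 0≤1 refl) 2≤S
  0≤S : 0ℚ ℚ.≤ S
  0≤S = ℚ.≤-trans 0≤1 1≤S
  0≤T : 0ℚ ℚ.≤ T
  0≤T = 0≤- S²≤M
  1≤M : 1ℚ ℚ.≤ M
  1≤M = ℚ.≤-trans
    (≤-by ((S ℚ.- 1ℚ) ℚ.* (S ℚ.+ 1ℚ)) (0≤* (0≤- 1≤S) (0≤+ 0≤S 0≤1))
      (solve 1 (λ S → con 1ℚ :+ (S :+ :- con 1ℚ) :* (S :+ con 1ℚ) := S :* S) refl S))
    S²≤M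
  2r≤E : (1ℚ ℚ.+ 1ℚ) ℚ.* r ℚ.≤ E
  2r≤E = sq-cancel-≤ {(1ℚ ℚ.+ 1ℚ) ℚ.* r} (0≤+ 0≤T (0≤* 0≤2 0≤S))
    (≤-by (((1ℚ ℚ.+ 1ℚ) ℚ.* (1ℚ ℚ.+ 1ℚ)) ℚ.* (M ℚ.- r ℚ.* r) ℚ.+
           (T ℚ.* T ℚ.+ ((1ℚ ℚ.+ 1ℚ) ℚ.* (1ℚ ℚ.+ 1ℚ)) ℚ.* (T ℚ.* (S ℚ.- 1ℚ))))
      (0≤+ (0≤* (0≤* 0≤2 0≤2) (0≤- r²≤M))
        (0≤+ (0≤* 0≤T 0≤T) (0≤* (0≤* 0≤2 0≤2) (0≤* 0≤T (0≤- 1≤S)))))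
      (solve 3 (λ S M r →
        let two = con 1ℚ :+ con 1ℚ
            T = M :+ :- (S :* S)
            E = T :+ two :* S
        in (two :* r) :* (two :* r) :+
           ((two :* two) :* (M :+ :- (r :* r)) :+
            (T :* T :+ (two :* two) :* (T :* (S :+ :- con 1ℚ)))) := E :* E) refl S M r))
  identity : ∀ S M r → let T = M ℚ.- S ℚ.* S; E = T ℚ.+ (1ℚ ℚ.+ 1ℚ) ℚ.* S in
    (S ℚ.* S ℚ.- 1ℚ) ℚ.* (S ℚ.* S ℚ.- (1ℚ ℚ.+ 1ℚ) ℚ.* S) ℚ.+
    ((M ℚ.- 1ℚ) ℚ.* (E ℚ.- (1ℚ ℚ.+ 1ℚ) ℚ.* r) ℚ.+ T ℚ.* (S ℚ.* (S ℚ.- (1ℚ ℚ.+ 1ℚ)))) ≡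
    (M ℚ.- 1ℚ) ℚ.* (M ℚ.- (1ℚ ℚ.+ 1ℚ) ℚ.* r)
  identity = solve 3 (λ S M r →
    let two = con 1ℚ :+ con 1ℚ
        T = M :+ :- (S :* S)
        E = T :+ two :* S
    in (S :* S :+ :- con 1ℚ) :* (S :* S :+ :- (two :* S)) :+
       ((M :+ :- con 1ℚ) :* (E :+ :- (two :* r)) :+ T :* (S :* (S :+ :- two))) :=
       (M :+ :- con 1ℚ) :* (M :+ :- (two :* r))) refl

-- Without a minimum, strong induction would show that P is empty.
¬¬-minimum : ∀ {P : ℕ → Set} {w} → P w → ¬ ¬ (∃[ v ] IsMinimum P v)
¬¬-minimum {P} {w} Pw no-min = <-rec (λ v → ¬ P v)
  (λ v smaller Pv → no-min (v , Pv , λ v′ Pv′ → ℕ.≮⇒≥ (λ v′<v → smaller v′<v Pv′))) w Pw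

-- The graph used for m edges: s = w + 2 = ⌊√m⌋, a clique on s + 1 vertices, and the
-- remaining q edges pendant at the hub.
module Construction (m w q : ℕ)
  (s²≤m : (2 ℕ.+ w) ℕ.* (2 ℕ.+ w) ℕ.≤ m) (m<[s+1]² : m ℕ.< (3 ℕ.+ w) ℕ.* (3 ℕ.+ w))
  (split : (3 ℕ.+ w) C 2 ℕ.+ q ≡ m)
  where

  s : ℕ
  s = 2 ℕ.+ w

  σ M N : ℚ
  σ = ι (suc w)
  M = ι m
  N = 1ℚ ℚ.+ (1ℚ ℚ.+ σ)

  ι-s : ι s ≡ 1ℚ ℚ.+ σ
  ι-s = ι-suc (suc w)

  ι-[s+1] : ι (suc s) ≡ N
  ι-[s+1] = trans (ι-suc s) (cong (1ℚ ℚ.+_) ι-s)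

  1≤σ : 1ℚ ℚ.≤ σ
  1≤σ = subst (ℚ._≤ σ) ι-1 (ι-mono-≤ (s≤s z≤n))

  0<N : 0ℚ ℚ.< N
  0<N = 0<1+ (0≤+ 0≤1 (0≤ι (suc w)))

  S²≤M : (1ℚ ℚ.+ σ) ℚ.* (1ℚ ℚ.+ σ) ℚ.≤ M
  S²≤M = subst (ℚ._≤ M) (trans (ι-* s s) (cong₂ ℚ._*_ ι-s ι-s)) (ι-mono-≤ s²≤m)

  M<N² : M ℚ.< N ℚ.* N
  M<N² = ℚ.<-≤-trans
    (subst (ℚ._< 1ℚ ℚ.+ M) (ℚ.+-identityˡ M) (ℚ.+-monoˡ-< M (ℚ.positive⁻¹ 1ℚ)))
    (subst₂ ℚ._≤_ (ι-suc m) (trans (ι-* (suc s) (suc s)) (cong₂ ℚ._*_ ι-[s+1] ι-[s+1]))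
      (ι-mono-≤ m<[s+1]²))

  size : M ℚ.+ M ≡ N ℚ.* (1ℚ ℚ.+ σ) ℚ.+ (ι q ℚ.+ ι q)
  size = begin
    ι m ℚ.+ ι m
      ≡⟨ ι-+ m m ⟨
    ι (m ℕ.+ m)
      ≡⟨ cong ι doubled ⟩
    ι (suc s ℕ.* s ℕ.+ (q ℕ.+ q))
      ≡⟨ ι-+ (suc s ℕ.* s) (q ℕ.+ q) ⟩
    ι (suc s ℕ.* s) ℚ.+ ι (q ℕ.+ q)
      ≡⟨ cong₂ ℚ._+_ (trans (ι-* (suc s) s) (cong₂ ℚ._*_ ι-[s+1] ι-s)) (ι-+ q q) ⟩
    N ℚ.* (1ℚ ℚ.+ σ) ℚ.+ (ι q ℚ.+ ι q) ∎
    where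
    open ≡-Reasoning
    doubled : m ℕ.+ m ≡ suc s ℕ.* s ℕ.+ (q ℕ.+ q)
    doubled = begin
      m ℕ.+ m                                    ≡⟨ cong₂ ℕ._+_ split split ⟨
      (suc s C 2 ℕ.+ q) ℕ.+ (suc s C 2 ℕ.+ q)    ≡⟨ regroup (suc s C 2) q ⟩
      2 ℕ.* (suc s C 2) ℕ.+ (q ℕ.+ q)            ≡⟨ cong (ℕ._+ (q ℕ.+ q)) (2*[n+1]C2 s) ⟩
      suc s ℕ.* s ℕ.+ (q ℕ.+ q)                  ∎
      where
      regroup : ∀ c q → (c ℕ.+ q) ℕ.+ (c ℕ.+ q) ≡ 2 ℕ.* c ℕ.+ (q ℕ.+ q)
      regroup = solve 2 (λ c q → (c :+ q) :+ (c :+ q) := con 2 :* c :+ (q :+ q)) refl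
        where open ℕ.+-*-Solver

  -- Newton's correction t = (N² - M) / 2N is at most 1, because N² - M ≤ N² - (N - 1)².
  admissible : Admissible m (pineapple s q)
  admissible = from (divide (ℚ.+-mono-< 0<N 0<N) (0<- M<N²))
    where
    from : ∃[ t ] (0ℚ ℚ.< t × (N ℚ.+ N) ℚ.* t ≡ N ℚ.* N ℚ.- M) → Admissible m (pineapple s q)
    from (t , 0<t , 2Nt≡N²-M) = record
      { size      = trans (#edges-pineapple s q) split
      ; radius    = root
      ; isRadius  = root-isRadius
      ; √m<radius = <root (√ m) (√-seq² m)
      }
      where
      newton : M ℚ.+ (N ℚ.* t ℚ.+ N ℚ.* t) ≡ N ℚ.* N
      newton = trans (cong (M ℚ.+_) (trans (sym (ℚ.*-distribʳ-+ t N N)) 2Nt≡N²-M))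
        (solve 2 (λ M n → M :+ (n :+ :- M) := n) refl M (N ℚ.* N))
        where open +-*-Solver
      t≤1 : t ℚ.≤ 1ℚ
      t≤1 = *-cancelˡ-0< (N ℚ.+ N) (ℚ.+-mono-< 0<N 0<N)
        (subst (ℚ._≤ (N ℚ.+ N) ℚ.* 1ℚ) (sym 2Nt≡N²-M)
          (≤-by ((M ℚ.- (1ℚ ℚ.+ σ) ℚ.* (1ℚ ℚ.+ σ)) ℚ.+ 1ℚ) (0≤+ (0≤- S²≤M) 0≤1)
            (solve 2 (λ M σ →
              let N = con 1ℚ :+ (con 1ℚ :+ σ)
              in (N :* N :+ :- M) :+ ((M :+ :- ((con 1ℚ :+ σ) :* (con 1ℚ :+ σ))) :+ con 1ℚ)
                 := (N :+ N) :* con 1ℚ) refl M σ)))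
        where open +-*-Solver
      open PineappleSpectrum (suc w) q M t 1≤σ 0<t t≤1 newton size

  #C₄≤ : ι (#C₄ (pineapple s q)) ℚ.≤
    ((1ℚ ℚ.+ σ) ℚ.* (1ℚ ℚ.+ σ) ℚ.- 1ℚ) ℚ.*
    ((1ℚ ℚ.+ σ) ℚ.* (1ℚ ℚ.+ σ) ℚ.- (1ℚ ℚ.+ 1ℚ) ℚ.* (1ℚ ℚ.+ σ)) ℚ.* eighth
  #C₄≤ = *-cancelˡ-0< (ι 8) (0<ι-suc 7) (begin
    ι 8 ℚ.* ι (#C₄ (pineapple s q))
      ≡⟨ ι-* 8 (#C₄ (pineapple s q)) ⟨
    ι (8 ℕ.* #C₄ (pineapple s q))
      ≤⟨ ι-mono-≤ (ℕ.≤-trans (ℕ.*-monoʳ-≤ 8 (#C₄-pineapple s q)) (ℕ.≤-reflexive 8*3)) ⟩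
    ι (suc s ℕ.* s ℕ.* suc w ℕ.* w)
      ≡⟨ ι-* (suc s ℕ.* s ℕ.* suc w) w ⟩
    ι (suc s ℕ.* s ℕ.* suc w) ℚ.* ι w
      ≡⟨ cong (ℚ._* ι w) (ι-* (suc s ℕ.* s) (suc w)) ⟩
    ι (suc s ℕ.* s) ℚ.* σ ℚ.* ι w
      ≡⟨ cong (λ z → z ℚ.* σ ℚ.* ι w) (trans (ι-* (suc s) s) (cong₂ ℚ._*_ ι-[s+1] ι-s)) ⟩
    N ℚ.* (1ℚ ℚ.+ σ) ℚ.* σ ℚ.* ι w
      ≡⟨ identity σ (ι w) (ι-suc w) ⟩
    product
      ≡⟨ ℚ.*-identityʳ product ⟨
    product ℚ.* 1ℚ
      ≡⟨ cong (product ℚ.*_) (trans (/-*-cancel 1 7) ι-1) ⟨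
    product ℚ.* (eighth ℚ.* ι 8)
      ≡⟨ rotate product eighth (ι 8) ⟩
    ι 8 ℚ.* (product ℚ.* eighth) ∎)
    where
    open ℚ.≤-Reasoning
    product : ℚ
    product = ((1ℚ ℚ.+ σ) ℚ.* (1ℚ ℚ.+ σ) ℚ.- 1ℚ) ℚ.*
              ((1ℚ ℚ.+ σ) ℚ.* (1ℚ ℚ.+ σ) ℚ.- (1ℚ ℚ.+ 1ℚ) ℚ.* (1ℚ ℚ.+ σ))
    8*3 : 8 ℕ.* (3 ℕ.* (suc s C 4)) ≡ suc s ℕ.* s ℕ.* suc w ℕ.* w
    8*3 = trans (sym (ℕ.*-assoc 8 3 (suc s C 4))) (24*[n+3]C4 w)
    rotate : ∀ a b c → a ℚ.* (b ℚ.* c) ≡ c ℚ.* (a ℚ.* b)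
    rotate = solve 3 (λ a b c → a :* (b :* c) := c :* (a :* b)) refl
      where open +-*-Solver
    identity : ∀ σ ω → σ ≡ 1ℚ ℚ.+ ω →
      (1ℚ ℚ.+ (1ℚ ℚ.+ σ)) ℚ.* (1ℚ ℚ.+ σ) ℚ.* σ ℚ.* ω ≡
      ((1ℚ ℚ.+ σ) ℚ.* (1ℚ ℚ.+ σ) ℚ.- 1ℚ) ℚ.*
      ((1ℚ ℚ.+ σ) ℚ.* (1ℚ ℚ.+ σ) ℚ.- (1ℚ ℚ.+ 1ℚ) ℚ.* (1ℚ ℚ.+ σ))
    identity _ ω refl = solve 1 (λ ω →
      let one = con 1ℚ
          σ = one :+ ω
          S = one :+ σ
      in (one :+ S) :* S :* σ :* ω :=
         (S :* S :+ :- one) :* (S :* S :+ :- ((one :+ one) :* S))) refl ω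
      where open +-*-Solver

  2≤S : 1ℚ ℚ.+ 1ℚ ℚ.≤ 1ℚ ℚ.+ σ
  2≤S = ℚ.+-monoʳ-≤ 1ℚ 1≤σ

  bound : ∀ v → v ℕ.≤ #C₄ (pineapple s q) →
    fromℕ v ≤ (fromℕ m - fromℕ 1) * (fromℕ m - fromℕ 2 * √ m) * fromℚ (+ 1 ℚ./ 8)
  bound v v≤ (mk< g 0<g (k , gap)) = ℚ.<-irrefl refl (begin-strict
    ι v           ≤⟨ bound-mono {1ℚ ℚ.+ σ} {ι m} {√-seq m k} 2≤S S²≤M (√-seq² m k) (ℚ.≤-trans (ι-mono-≤ v≤) #C₄≤) ⟩
    X (ι m)       <⟨ subst (ℚ._< X (ι m) ℚ.+ g) (ℚ.+-identityʳ (X (ι m))) (ℚ.+-monoʳ-< (X (ι m)) 0<g) ⟩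
    X (ι m) ℚ.+ g ≤⟨ subst₂ ℚ._≤_ (cong (λ z → X z ℚ.+ g) (/1≡ι m)) (/1≡ι v) (gap k ℕ.≤-refl) ⟩
    ι v           ∎)
    where
    open ℚ.≤-Reasoning
    X : ℚ → ℚ
    X z = (z ℚ.- 1ℚ) ℚ.* (z ℚ.- (1ℚ ℚ.+ 1ℚ) ℚ.* √-seq m k) ℚ.* eighth

proposition1 : (m : ℕ) → 4 ℕ.≤ m →
    (¬ ¬ (∃[ v ] f⟨ m ⟩≡ v)) ×
    ((v : ℕ) → f⟨ m ⟩≡ v →
    fromℕ v ≤ (fromℕ m - fromℕ 1) * (fromℕ m - fromℕ 2 * √ m) * fromℚ (+ 1 ℚ./ 8))
proposition1 m 4≤m = from (isqrt m) (isqrt-lower m) (isqrt-upper m)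
  where
  from : ∀ s → s ℕ.* s ℕ.≤ m → m ℕ.< suc s ℕ.* suc s →
    (¬ ¬ (∃[ v ] f⟨ m ⟩≡ v)) ×
    ((v : ℕ) → f⟨ m ⟩≡ v →
    fromℕ v ≤ (fromℕ m - fromℕ 1) * (fromℕ m - fromℕ 2 * √ m) * fromℚ (+ 1 ℚ./ 8))
  from zero          _    m<1       = contradiction (ℕ.<-≤-trans m<1 (ℕ.≤-trans (s≤s z≤n) 4≤m)) (ℕ.<-irrefl refl)
  from (suc zero)    _    m<4       = contradiction (ℕ.<-≤-trans m<4 4≤m) (ℕ.<-irrefl refl)
  from s@(suc (suc w)) s²≤m m<[s+1]² =
    ¬¬-minimum witness , λ v (_ , minimal) → bound v (minimal (#C₄ (pineapple s q)) witness)
    where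
    clique≤m : suc s C 2 ℕ.≤ m
    clique≤m = ℕ.*-cancelˡ-≤ 2 (begin
      2 ℕ.* (suc s C 2)    ≡⟨ 2*[n+1]C2 s ⟩
      s ℕ.+ s ℕ.* s        ≤⟨ ℕ.+-monoˡ-≤ (s ℕ.* s) (ℕ.m≤m*n s s) ⟩
      s ℕ.* s ℕ.+ s ℕ.* s ≤⟨ ℕ.+-mono-≤ s²≤m s²≤m ⟩
      m ℕ.+ m              ≡⟨ cong (m ℕ.+_) (ℕ.+-identityʳ m) ⟨
      2 ℕ.* m              ∎)
      where open ℕ.≤-Reasoning
    q : ℕ
    q = m ℕ.∸ suc s C 2
    open Construction m w q s²≤m m<[s+1]² (ℕ.m+[n∸m]≡n clique≤m)
      using (admissible; bound)
    witness : ∃[ n ] ∃[ G ] (Admissible m {n} G × #C₄ G ≡ #C₄ (pineapple s q))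
    witness = _ , pineapple s q , admissible , refl
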